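{- For every union-find-explain data structure $ufe$, every $n\in\mathbb{N}$, every imperative representation $imp$ (of record type $\mathsf{ufe\_c\_imp}$) and all $x,y\in\mathbb{N}$, the following separation-logic Hoare triple, read in the sense of total correctness, holds: $$\langle\,\mathsf{is\_ufe\_c}\ (ufe,n)\ imp\,\rangle\ \ \mathsf{explain\_partial\_imp}\ imp\ x\ y\ \ \langle\,\lambda r.\ \mathsf{is\_ufe\_c}\ (ufe,n)\ imp\ *\ \uparrow\!(r=\mathsf{explain\_partial}\ ufe\ x\ y)\,\rangle_t .$$ That is, run on any heap in which $imp$ represents $ufe$ (with element set $\{0,\dots,n-1\}$), the program terminates without failure, returns $\mathsf{explain\_partial}\ ufe\ x\ y$, and leaves a heap in which $imp$ still represents $ufe$.
   Context: Union-find (UF) data structures. A UF data structure $uf$ is a finite list $l$ of natural numbers, of length $n$, such that for every $i<n$ we have $l\,!\,i<n$ and following parents from $i$ eventually reaches a root, i.e. an index $j$ with $l\,!\,j=j$. For $i<n$, $\mathsf{ufa\_parent\_of}\ uf\ i=l\,!\,i$, and $\mathsf{ufa\_rep\_of}\ uf\ i$ is the root reached from $i$ (for $i\ge n$ unspecified). The represented partial equivalence relation is $\mathsf{ufa\_\alpha}\ uf=\{(x,y)\mid x,y<n,\ \mathsf{ufa\_rep\_of}\ uf\ x=\mathsf{ufa\_rep\_of}\ uf\ y\}$; its field is $\{0,\dots,n-1\}$. For $x,y<n$, $\mathsf{ufa\_union}\ uf\ x\ y$ is obtained from $l$ by setting the entry at index $\mathsf{ufa\_rep\_of}\ uf\ x$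 to $\mathsf{ufa\_rep\_of}\ uf\ y$. $\mathsf{eff\_union}\ uf\ a\ b$ means $a,b\in\mathrm{Field}(\mathsf{ufa\_\alpha}\ uf)$ and $\mathsf{ufa\_rep\_of}\ uf\ a\neq\mathsf{ufa\_rep\_of}\ uf\ b$. $\mathsf{ufa\_unions}\ uf\ us$ performs the unions in $us$ from left to right, and $\mathsf{eff\_unions}\ uf\ us$ means that each pair in $us$ is an effective union with respect to the UF data structure resulting from the preceding unions. Union-find-explain (UFE) data structures. A UFE data structure $ufe$ is a pair $(uf,us)$ with $\mathsf{ufa\_\alpha}\ uf\subseteq\mathrm{Id}$ and $\mathsf{eff\_unions}\ uf\ us$. Put $\mathsf{unions}\ ufe=us$, $\mathsf{uf\_ds}\ ufe=\mathsf{ufa\_unions}\ uf\ us$, and for $F\in\{\mathsf{rep\_of},\mathsf{parent\_of},\mathsf{\alpha},\mathsf{lca}\}$ let $\mathsf{ufe\_}F\ ufe=\mathsf{ufa\_}F(\mathsf{uf\_ds}\ ufe)$. For an effective union, $\mathsf{ufe\_union}\ ufe\ a\ b=(uf,us\,@\,[(a,b)])$; $\mathsf{rollback}\ ufe$ removes the last pair of $us$. Functional specification. $\mathsf{equivcl}\ r=(r\cup r^{ -1})^{*}$ (reflexive on all of $\mathbb{N}$). Proof terms are generated by $\mathsf{AssmP}\ i$, $\mathsf{ReflP}\ x$, $\mathsf{SymP}\ p$, $p_1\bigtriangledown p_2$ (one fixed associativity convention for $\bigtriangledown$). $\mathsf{explain}\ ufe\ x\ y=\mathsf{ReflP}\ x$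 if $\mathsf{unions}\ ufe=[\,]$. Otherwise, with $ufe_0=\mathsf{rollback}\ ufe$, $(a,b)$ the last element of $\mathsf{unions}\ ufe$ and $q=\mathsf{AssmP}\ |\mathsf{unions}\ ufe_0|$, it is: $\mathsf{explain}\ ufe_0\ x\ y$ if $\mathsf{ufe\_rep\_of}\ ufe_0\ x=\mathsf{ufe\_rep\_of}\ ufe_0\ y$; else $\mathsf{explain}\ ufe_0\ x\ a\bigtriangledown q\bigtriangledown\mathsf{explain}\ ufe_0\ b\ y$ if $\mathsf{ufe\_rep\_of}\ ufe_0\ x=\mathsf{ufe\_rep\_of}\ ufe_0\ a$; else $\mathsf{explain}\ ufe_0\ x\ b\bigtriangledown\mathsf{SymP}\ q\bigtriangledown\mathsf{explain}\ ufe_0\ a\ y$. Finally $\mathsf{explain\_partial}\ ufe\ x\ y=\mathsf{Some}(\mathsf{explain}\ ufe\ x\ y)$ if $(x,y)\in\mathsf{equivcl}(\mathsf{set}(\mathsf{unions}\ ufe))$, and $\mathsf{None}$ otherwise. Efficient recursion scheme. $\mathsf{ufa\_lca}\ uf\ x\ y$ is the last element of the longest common prefix of the lists of vertices on the parent-pointer paths from the representative of $x$ to $x$ and from the representative of $y$ to $y$. $\mathsf{au\_ds}\ ufe:\mathbb{N}\to\mathbb{N}\ \mathsf{option}$ is everywhere $\mathsf{None}$ if $\mathsf{unions}\ ufe=[\,]$, and for an effective union $(a,b)$, $\mathsf{au\_ds}(\mathsf{ufe\_union}\ ufe\ a\ b)$ agrees with $\mathsf{au\_ds}\ ufe$ except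 that it maps $\mathsf{ufe\_rep\_of}\ ufe\ a$ to $\mathsf{Some}\ |\mathsf{unions}\ ufe|$. $\mathsf{find\_newest\_on\_path}\ ufe\ y\ x$ is $\mathsf{None}$ if $y=x$ and otherwise $\max(\mathsf{au\_ds}\ ufe\ x,\mathsf{find\_newest\_on\_path}\ ufe\ y\ (\mathsf{ufe\_parent\_of}\ ufe\ x))$, with $\mathsf{None}<\mathsf{Some}\ i$ and $\mathsf{Some}\ i\le\mathsf{Some}\ j\iff i\le j$. $\mathsf{explain'}\ ufe\ x\ y=\mathsf{ReflP}\ x$ if $x=y$; otherwise let $c=\mathsf{ufe\_lca}\ ufe\ x\ y$, $N_x=\mathsf{find\_newest\_on\_path}\ ufe\ c\ x$, $N_y=\mathsf{find\_newest\_on\_path}\ ufe\ c\ y$; if $N_y\le N_x=\mathsf{Some}\ i$ and $(ax,bx)=\mathsf{unions}\ ufe\,!\,i$, the value is $\mathsf{explain'}\ ufe\ x\ ax\bigtriangledown\mathsf{AssmP}\ i\bigtriangledown\mathsf{explain'}\ ufe\ bx\ y$; otherwise, with $N_y=\mathsf{Some}\ j$ and $(ay,by)=\mathsf{unions}\ ufe\,!\,j$, it is $\mathsf{explain'}\ ufe\ x\ by\bigtriangledown\mathsf{SymP}(\mathsf{AssmP}\ j)\bigtriangledown\mathsf{explain'}\ ufe\ ay\ y$. Imperative representation (programs in a heap monad with mutable arrays, as in Imperative HOL). A UF data structure is stored as an array of integers: at a root the entry is the negative of the size of its equivalence class, at a non-root it is the parent index. A record of type $\mathsf{ufe\_imp}$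 consists of such a UF array, an array of natural-number options (associated unions), and a dynamic array of pairs (an array together with the number of occupied cells, counted from the first position). The assertion $\mathsf{is\_ufe}\ (ufe,n)$ on such a record says that the initial UF data structure has elements $0,\dots,n-1$, the first array represents $\mathsf{uf\_ds}\ ufe$, the second has length $n$ and holds $\mathsf{au\_ds}\ ufe\ i$ at index $i<n$, and the dynamic array holds $\mathsf{unions}\ ufe$. A record of type $\mathsf{ufe\_c\_imp}$ extends $\mathsf{ufe\_imp}$ by a further UF array, on which find operations perform path compression; $\mathsf{is\_ufe\_c}\ (ufe,n)\ imp$ is the separating conjunction of $\mathsf{is\_ufe}\ (ufe,n)$ on the $\mathsf{ufe\_imp}$ part with the assertion that the further array represents some UF data structure on $\{0,\dots,n-1\}$ whose representatives coincide with $\mathsf{ufe\_rep\_of}\ ufe$. The program $\mathsf{explain\_partial\_imp}\ imp\ x\ y$ is the imperative version of $\mathsf{explain'}$ guarded by a validity check: it tests whether $x=y$ or ($x<n$, $y<n$ and $x,y$ have the same representative, computed by find on the path-compressed array); if so it executes the recursion of $\mathsf{explain'}$, reading parents, associated unions and unions from the arrays, and returns $\mathsf{Some}$ of the resulting proof term; otherwise it returns $\mathsf{None}$. Separation logic. $*$ is separating conjunction, $\uparrow\!(\phi)$ is the assertion that the heap part is empty and $\phi$ holds. $\langle P\rangle\,c\,\langle Q\rangle_t$ means: started in any heap satisfying $P$ (with arbitrary frame, which is preserved), $c$ terminates without failure with some result $r$, and the resulting heap satisfies $Q\,r*\mathsf{true}$ (leftover newly allocated memory is allowed). -}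

module Defs where

open import Data.Bool.Base using (Bool; true; false; if_then_else_)
open import Data.Integer.Base as ℤ using (ℤ; +_; -[1+_])
open import Data.List.Base
  using (List; []; _∷_; _∷ʳ_; length; map; filter; upTo; take; last; replicate)
open import Data.List.Membership.Propositional using (_∈_)
open import Data.List.Relation.Unary.Any using (here; there)
open import Data.List.Reverse using (Reverse; []; _∶_∶ʳ_; reverseView)
open import Data.Maybe.Base using (Maybe; just; nothing; fromMaybe)
open import Data.Maybe.Properties using (just-injective)
open import Data.Nat.Base using (ℕ; zero; suc; _≤_; _<_; s≤s)
open import Data.Nat.Properties using (_≟_; _≤?_; _<?_)
open import Data.Product.Base using (∃-syntax; Σ-syntax; _×_; _,_; proj₁; proj₂)
open import Data.Sum.Base using (_⊎_; inj₁; inj₂)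
open import Data.Unit.Base using (⊤; tt)
open import Level using (0ℓ)
open import Relation.Binary.Construct.Add.Infimum.NonStrict _≤_ using (≤₋-dec)
open import Relation.Binary.Construct.Closure.Equivalence as EqC using (EqClosure)
open import Relation.Binary.Construct.Closure.ReflexiveTransitive using (Star; ε; _◅_; _◅◅_)
open import Relation.Binary.Construct.Closure.Symmetric using (fwd; bwd)
open import Relation.Binary.Core using (Rel; _⇒_)
open import Relation.Binary.PropositionalEquality
  using (_≡_; _≢_; refl; sym; trans; cong; subst)
open import Relation.Nullary.Decidable using (Dec; yes; no; does; map′; _×-dec_; _⊎-dec_)
open import Relation.Nullary.Negation using (contradiction)

module _ {A : Set} where

  infixl 8 _!?_
  _!?_ : List A → ℕ → Maybe A
  []       !? _     = nothing
  (x ∷ xs) !? zero  = just x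
  (x ∷ xs) !? suc i = xs !? i

  -- No effect if the index is out of range.
  infixl 8 _[_]≔_
  _[_]≔_ : List A → ℕ → A → List A
  []       [ _     ]≔ _ = []
  (x ∷ xs) [ zero  ]≔ y = y ∷ xs
  (x ∷ xs) [ suc i ]≔ y = x ∷ xs [ i ]≔ y

  length-≔ : ∀ xs i {y} → length (xs [ i ]≔ y) ≡ length xs
  length-≔ []       _       = refl
  length-≔ (x ∷ xs) zero    = refl
  length-≔ (x ∷ xs) (suc i) = cong suc (length-≔ xs i)

  longest-common-prefix : (∀ (x y : A) → Dec (x ≡ y)) → List A → List A → List A
  longest-common-prefix _≟ᴬ_ (x ∷ xs) (y ∷ ys) =
    if does (x ≟ᴬ y) then x ∷ longest-common-prefix _≟ᴬ_ xs ys else []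
  longest-common-prefix _    _        _        = []

-- The value at an out-of-range index is irrelevant; it is taken to be the
-- index itself.
infixl 8 _!_
_!_ : List ℕ → ℕ → ℕ
l ! i = fromMaybe i (l !? i)

Root : List ℕ → ℕ → Set
Root l j = l ! j ≡ j

Parent : List ℕ → Rel ℕ 0ℓ
Parent l i j = l ! i ≡ j

ReachesRoot : List ℕ → ℕ → Set
ReachesRoot l i = ∃[ j ] Star (Parent l) i j × Root l j

record UF : Set where
  field
    parents : List ℕ
    bounded : ∀ {i} → i < length parents → parents ! i < length parents
    rooted  : ∀ {i} → i < length parents → ReachesRoot parents i

  size : ℕ
  size = length parents

open UF public

ufa-parent-of : UF → ℕ → ℕ
ufa-parent-of uf i = parents uf ! i

-- The value for i ≥ size uf is irrelevant.
ufa-rep-of : UF → ℕ → ℕ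
ufa-rep-of uf i with i <? size uf
... | yes i<n = proj₁ (rooted uf i<n)
... | no  _   = i

ufa-α : UF → Rel ℕ 0ℓ
ufa-α uf x y = x < size uf × y < size uf × ufa-rep-of uf x ≡ ufa-rep-of uf y

Field : Rel ℕ 0ℓ → ℕ → Set
Field R a = ∃[ b ] (R a b ⊎ R b a)

!-≔-same : ∀ l i {y} → i < length l → l [ i ]≔ y ! i ≡ y
!-≔-same l i {y} i<n = cong (fromMaybe i) (go l i i<n)
  where
  go : ∀ (l : List ℕ) i → i < length l → l [ i ]≔ y !? i ≡ just y
  go (x ∷ l) zero    _               = refl
  go (x ∷ l) (suc i) (s≤s i<n) = go l i i<n

!-≔-other : ∀ l i j {y} → i ≢ j → l [ i ]≔ y ! j ≡ l ! j
!-≔-other l i j {y} i≢j = cong (fromMaybe j) (go l i j i≢j)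
  where
  go : ∀ (l : List ℕ) i j → i ≢ j → l [ i ]≔ y !? j ≡ l !? j
  go []      _       _       _   = refl
  go (x ∷ l) zero    zero    i≢j = contradiction refl i≢j
  go (x ∷ l) zero    (suc j) _   = refl
  go (x ∷ l) (suc i) zero    _   = refl
  go (x ∷ l) (suc i) (suc j) i≢j = go l i j (λ i≡j → i≢j (cong suc i≡j))

star-bounded : ∀ uf {i j} → i < size uf → Star (Parent (parents uf)) i j → j < size uf
star-bounded uf i<n ε            = i<n
star-bounded uf i<n (refl ◅ i⟶j) = star-bounded uf (bounded uf i<n) i⟶j

rep-bounded : ∀ uf {i} → i < size uf → ufa-rep-of uf i < size uf
rep-bounded uf {i} i<n with i <? size uf
... | yes i<n′ = star-bounded uf i<n′ (proj₁ (proj₂ (rooted uf i<n′)))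
... | no  i≮n  = contradiction i<n i≮n

rep-root : ∀ uf {i} → i < size uf → Root (parents uf) (ufa-rep-of uf i)
rep-root uf {i} i<n with i <? size uf
... | yes i<n′ = proj₂ (proj₂ (rooted uf i<n′))
... | no  i≮n  = contradiction i<n i≮n

module Link (uf : UF) {rx ry : ℕ} (rx<n : rx < size uf) (ry<n : ry < size uf)
            (root-rx : Root (parents uf) rx) (root-ry : Root (parents uf) ry) where

  l l′ : List ℕ
  l  = parents uf
  l′ = l [ rx ]≔ ry

  bounded′ : ∀ {i} → i < length l′ → l′ ! i < length l′
  bounded′ {i} i<n rewrite length-≔ l rx {ry} with rx ≟ i
  ... | yes refl rewrite !-≔-same l rx {ry} rx<n = ry<n
  ... | no  rx≢i rewrite !-≔-other l rx i {ry} rx≢i = bounded uf i<n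

  root-ry′ : Root l′ ry
  root-ry′ with rx ≟ ry
  ... | yes refl  = !-≔-same l rx rx<n
  ... | no  rx≢ry = trans (!-≔-other l rx ry rx≢ry) root-ry

  rooted′ : ∀ {i j} → Star (Parent l) i j → Root l j → ReachesRoot l′ i
  rooted′ {i} i⟶j root-j with rx ≟ i
  rooted′ i⟶j root-j | yes refl = ry , !-≔-same l rx rx<n ◅ ε , root-ry′
  rooted′ {i} ε root-i | no rx≢i = i , ε , trans (!-≔-other l rx i rx≢i) root-i
  rooted′ {i} (refl ◅ p⟶j) root-j | no rx≢i =
    let k , p⟶k , root-k = rooted′ p⟶j root-j
    in  k , !-≔-other l rx i rx≢i ◅ p⟶k , root-k

  link : UF
  link = record
    { parents = l′
    ; bounded = bounded′
    ; rooted  = λ {i} i<n →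
        let _ , i⟶j , root-j = rooted uf (subst (i <_) (length-≔ l rx) i<n)
        in  rooted′ i⟶j root-j
    }

union-dec : ∀ uf x y → Dec (x < size uf) → Dec (y < size uf) → UF
union-dec uf x y (yes x<n) (yes y<n) =
  Link.link uf (rep-bounded uf x<n) (rep-bounded uf y<n) (rep-root uf x<n) (rep-root uf y<n)
union-dec uf x y _         _         = uf

-- Only specified for x , y < size uf; otherwise uf is left unchanged.
ufa-union : UF → ℕ → ℕ → UF
ufa-union uf x y = union-dec uf x y (x <? size uf) (y <? size uf)

parents-ufa-union : ∀ uf {x y} → x < size uf → y < size uf →
  parents (ufa-union uf x y) ≡ parents uf [ ufa-rep-of uf x ]≔ ufa-rep-of uf y
parents-ufa-union uf {x} {y} x<n y<n = go (x <? size uf) (y <? size uf)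
  where
  go : ∀ dx dy → parents (union-dec uf x y dx dy) ≡ parents uf [ ufa-rep-of uf x ]≔ ufa-rep-of uf y
  go (yes _)  (yes _)  = refl
  go (no x≮n) _        = contradiction x<n x≮n
  go (yes _)  (no y≮n) = contradiction y<n y≮n

EffUnion : UF → ℕ → ℕ → Set
EffUnion uf a b =
  Field (ufa-α uf) a × Field (ufa-α uf) b × ufa-rep-of uf a ≢ ufa-rep-of uf b

ufa-unions : UF → List (ℕ × ℕ) → UF
ufa-unions uf []             = uf
ufa-unions uf ((a , b) ∷ us) = ufa-unions (ufa-union uf a b) us

EffUnions : UF → List (ℕ × ℕ) → Set
EffUnions uf []             = ⊤
EffUnions uf ((a , b) ∷ us) = EffUnion uf a b × EffUnions (ufa-union uf a b) us

record UFE : Set where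
  field
    uf-init  : UF
    unions   : List (ℕ × ℕ)
    discrete : ufa-α uf-init ⇒ _≡_
    eff      : EffUnions uf-init unions

  uf-ds : UF
  uf-ds = ufa-unions uf-init unions

open UFE public

ufe-rep-of : UFE → ℕ → ℕ
ufe-rep-of ufe = ufa-rep-of (uf-ds ufe)

infixr 6 _▽_

data Proof : Set where
  AssmP ReflP : ℕ → Proof
  SymP        : Proof → Proof
  _▽_         : Proof → Proof → Proof

-- Recursion on the list of unions from its end; passing from
-- us ∶ rs ∶ʳ (a , b) to rs is the rollback of the last union (a , b).
module _ (uf : UF) where

  explain-rev : ∀ {us : List (ℕ × ℕ)} → Reverse us → ℕ → ℕ → Proof
  explain-rev []                    x y = ReflP x
  explain-rev (us ∶ rs ∶ʳ (a , b)) x y =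
    if does (rep x ≟ rep y) then explain-rev rs x y
    else if does (rep x ≟ rep a) then explain-rev rs x a ▽ q ▽ explain-rev rs b y
    else explain-rev rs x b ▽ SymP q ▽ explain-rev rs a y
    where
    rep : ℕ → ℕ
    rep = ufa-rep-of (ufa-unions uf us)
    q : Proof
    q = AssmP (length us)

  au-rev : ∀ {us : List (ℕ × ℕ)} → Reverse us → ℕ → Maybe ℕ
  au-rev []                   i = nothing
  au-rev (us ∶ rs ∶ʳ (a , b)) i =
    if does (i ≟ ufa-rep-of (ufa-unions uf us) a) then just (length us) else au-rev rs i

explain : UFE → ℕ → ℕ → Proof
explain ufe = explain-rev (uf-init ufe) (reverseView (unions ufe))

au-ds : UFE → ℕ → Maybe ℕ
au-ds ufe = au-rev (uf-init ufe) (reverseView (unions ufe))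

equivcl : List (ℕ × ℕ) → Rel ℕ 0ℓ
equivcl us = EqClosure (λ x y → (x , y) ∈ us)

equivcl? : ∀ us x y → Dec (equivcl us x y)
equivcl? []             x y = map′ (λ { refl → ε }) (λ { ε → refl ; (fwd () ◅ _) ; (bwd () ◅ _) }) (x ≟ y)
equivcl? ((a , b) ∷ us) x y =
  map′ to from
    (equivcl? us x y ⊎-dec
      ((equivcl? us x a ×-dec equivcl? us b y) ⊎-dec (equivcl? us x b ×-dec equivcl? us a y)))
  where
  _~_ : Rel ℕ 0ℓ
  _~_ = equivcl us

  Connected : Rel ℕ 0ℓ
  Connected x y = x ~ y ⊎ (x ~ a × b ~ y) ⊎ (x ~ b × a ~ y)

  weaken : ∀ {x y} → x ~ y → equivcl ((a , b) ∷ us) x y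
  weaken = EqC.map there

  to : ∀ {x y} → Connected x y → equivcl ((a , b) ∷ us) x y
  to (inj₁ p)              = weaken p
  to (inj₂ (inj₁ (p , q))) = weaken p ◅◅ fwd (here refl) ◅ weaken q
  to (inj₂ (inj₂ (p , q))) = weaken p ◅◅ bwd (here refl) ◅ weaken q

  prepend : ∀ {x y z} → x ~ y → Connected y z → Connected x z
  prepend p (inj₁ q)              = inj₁ (p ◅◅ q)
  prepend p (inj₂ (inj₁ (q , r))) = inj₂ (inj₁ (p ◅◅ q , r))
  prepend p (inj₂ (inj₂ (q , r))) = inj₂ (inj₂ (p ◅◅ q , r))

  from : ∀ {x y} → equivcl ((a , b) ∷ us) x y → Connected x y
  from ε                     = inj₁ ε
  from (fwd (there p)   ◅ r) = prepend (fwd p ◅ ε) (from r)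
  from (bwd (there p)   ◅ r) = prepend (bwd p ◅ ε) (from r)
  from (fwd (here refl) ◅ r) with from r
  ... | inj₁ p              = inj₂ (inj₁ (ε , p))
  ... | inj₂ (inj₁ (_ , q)) = inj₂ (inj₁ (ε , q))
  ... | inj₂ (inj₂ (_ , q)) = inj₁ q
  from (bwd (here refl) ◅ r) with from r
  ... | inj₁ p              = inj₂ (inj₂ (ε , p))
  ... | inj₂ (inj₁ (_ , q)) = inj₁ q
  ... | inj₂ (inj₂ (_ , q)) = inj₂ (inj₂ (ε , q))

explain-partial : UFE → ℕ → ℕ → Maybe Proof
explain-partial ufe x y with equivcl? (unions ufe) x y
... | yes _ = just (explain ufe x y)
... | no  _ = nothing

data Ty : Set where
  int maybe-nat nat-pair : Ty

⟦_⟧ : Ty → Set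
⟦ int       ⟧ = ℤ
⟦ maybe-nat ⟧ = Maybe ℕ
⟦ nat-pair  ⟧ = ℕ × ℕ

record Array (t : Ty) : Set where
  constructor mkArray
  field addr : ℕ

open Array public

Cell : Set
Cell = Σ[ t ∈ Ty ] List ⟦ t ⟧

-- The position in the list is the address; allocation appends a cell.
Heap : Set
Heap = List Cell

-- A program may call the procedures named by Proc. Their bodies, which are
-- programs again, are supplied only in Semantics; thus arbitrary recursion is
-- expressible, and termination is a property of the semantics.

module HeapMonad (Proc : Set → Set → Set₁) where

  infixl 1 _>>=_ _>>_

  data Cmd : Set → Set₁ where
    return : ∀ {A} → A → Cmd A
    _>>=_  : ∀ {A B} → Cmd A → (A → Cmd B) → Cmd B
    raise  : ∀ {A} → Cmd A
    new    : ∀ {t} → ℕ → ⟦ t ⟧ → Cmd (Array t)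
    len    : ∀ {t} → Array t → Cmd ℕ
    nth    : ∀ {t} → Array t → ℕ → Cmd ⟦ t ⟧
    upd    : ∀ {t} → Array t → ℕ → ⟦ t ⟧ → Cmd ⊤
    call   : ∀ {A B} → Proc A B → A → Cmd B

  _>>_ : ∀ {A B} → Cmd A → Cmd B → Cmd B
  c >> d = c >>= λ _ → d

  module Semantics (body : ∀ {A B} → Proc A B → A → Cmd B) where

    -- c , h ⇓ r , h′ : started in h, the program c terminates without failure,
    -- with result r and final heap h′. There is no rule for raise, nor for
    -- accesses to missing cells or out of the bounds of an array.
    infix 4 _,_⇓_,_

    data _,_⇓_,_ : ∀ {A} → Cmd A → Heap → A → Heap → Set₁ where

      ⇓return : ∀ {A} {x : A} {h} →
        return x , h ⇓ x , h

      ⇓bind : ∀ {A B} {c : Cmd A} {k : A → Cmd B} {h h′ h″ x y} →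
        c , h ⇓ x , h′ → k x , h′ ⇓ y , h″ →
        (c >>= k) , h ⇓ y , h″

      ⇓new : ∀ {t n} {v : ⟦ t ⟧} {h} →
        new n v , h ⇓ mkArray (length h) , (h ∷ʳ (t , replicate n v))

      ⇓len : ∀ {t} {a : Array t} {h xs} →
        h !? addr a ≡ just (t , xs) →
        len a , h ⇓ length xs , h

      ⇓nth : ∀ {t} {a : Array t} {i h xs v} →
        h !? addr a ≡ just (t , xs) → xs !? i ≡ just v →
        nth a i , h ⇓ v , h

      ⇓upd : ∀ {t} {a : Array t} {i v h xs} →
        h !? addr a ≡ just (t , xs) → i < length xs →
        upd a i v , h ⇓ tt , (h [ addr a ]≔ (t , xs [ i ]≔ v))

      ⇓call : ∀ {A B} {p : Proc A B} {x y h h′} →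
        body p x , h ⇓ y , h′ →
        call p x , h ⇓ y , h′

    private
      same-cell : ∀ {t xs ys} {m : Maybe Cell} →
        m ≡ just (t , xs) → m ≡ just (t , ys) → xs ≡ ys
      same-cell refl refl = refl

    -- Hence in a Hoare triple "there is a terminating run such that …" says the
    -- same as "the program terminates, and every run is such that …".
    ⇓-deterministic : ∀ {A} {c : Cmd A} {h r r′ h₁ h₂} →
      c , h ⇓ r , h₁ → c , h ⇓ r′ , h₂ → r ≡ r′ × h₁ ≡ h₂
    ⇓-deterministic ⇓return ⇓return = refl , refl
    ⇓-deterministic (⇓bind p q) (⇓bind p′ q′) with ⇓-deterministic p p′
    ... | refl , refl = ⇓-deterministic q q′
    ⇓-deterministic ⇓new ⇓new = refl , refl
    ⇓-deterministic (⇓len p) (⇓len p′) with same-cell p p′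
    ... | refl = refl , refl
    ⇓-deterministic (⇓nth p q) (⇓nth p′ q′) with same-cell p p′
    ... | refl = just-injective (trans (sym q) q′) , refl
    ⇓-deterministic (⇓upd p _) (⇓upd p′ _) with same-cell p p′
    ... | refl = refl , refl
    ⇓-deterministic (⇓call p) (⇓call p′) = ⇓-deterministic p p′

Heaplet : Set
Heaplet = ℕ → Maybe Cell

⌊_⌋ : Heap → Heaplet
⌊ h ⌋ a = h !? a

-- h is the union of the disjoint heaplets h₁ and h₂.
Splits : Heaplet → Heaplet → Heaplet → Set
Splits h h₁ h₂ = ∀ a → (h₁ a ≡ h a × h₂ a ≡ nothing) ⊎ (h₁ a ≡ nothing × h₂ a ≡ h a)

Assn : Set₁
Assn = Heaplet → Set

infixr 5 _∗_
infix 6 _↦_ ↑_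

_∗_ : Assn → Assn → Assn
(P ∗ Q) h = ∃[ h₁ ] ∃[ h₂ ] Splits h h₁ h₂ × P h₁ × Q h₂

↑_ : Set → Assn
(↑ φ) h = (∀ a → h a ≡ nothing) × φ

true-assn : Assn
true-assn _ = ⊤

∃ₐ : {X : Set} → (X → Assn) → Assn
∃ₐ P h = ∃[ x ] P x h

_↦_ : ∀ {t} → Array t → List ⟦ t ⟧ → Assn
_↦_ {t} a xs h = h (addr a) ≡ just (t , xs) × (∀ b → b ≢ addr a → h b ≡ nothing)

module HoareLogic (Proc : Set → Set → Set₁)
                  (body : ∀ {A B} → Proc A B → A → HeapMonad.Cmd Proc B) where

  open HeapMonad Proc
  open Semantics body public

  ⟨_⟩_⟨_⟩ₜ : ∀ {A} → Assn → Cmd A → (A → Assn) → Set₁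
  ⟨ P ⟩ c ⟨ Q ⟩ₜ = ∀ h hₚ frame → Splits ⌊ h ⌋ hₚ frame → P hₚ →
    ∃[ r ] ∃[ h′ ] ∃[ hq ]
      (c , h ⇓ r , h′) × Splits ⌊ h′ ⌋ hq frame × (Q r ∗ true-assn) hq

UFImp : Set
UFImp = Array int

-- A backing array and the number of occupied cells.
DynArray : Ty → Set
DynArray t = Array t × ℕ

record UFEImp : Set where
  field
    uf-imp     : UFImp
    au-imp     : Array maybe-nat
    unions-imp : DynArray nat-pair

record UFECImp : Set where
  field
    ufe-imp  : UFEImp
    uf-c-imp : UFImp
  open UFEImp ufe-imp public

open UFECImp public

class-size : UF → ℕ → ℕ
class-size uf i = length (filter (λ j → ufa-rep-of uf j ≟ ufa-rep-of uf i) (upTo (size uf)))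

uf-entry : UF → ℕ → ℤ
uf-entry uf i =
  if does (ufa-parent-of uf i ≟ i) then ℤ.- (+ class-size uf i) else + ufa-parent-of uf i

is-uf : UF → UFImp → Assn
is-uf uf a = a ↦ map (uf-entry uf) (upTo (size uf))

is-dyn-array : ∀ {t} → List ⟦ t ⟧ → DynArray t → Assn
is-dyn-array xs (a , k) = ∃ₐ λ ys → a ↦ ys ∗ ↑ (k ≤ length ys × take k ys ≡ xs)

is-ufe : UFE × ℕ → UFEImp → Assn
is-ufe (ufe , n) imp =
    ↑ (size (uf-init ufe) ≡ n)
  ∗ is-uf (uf-ds ufe) (UFEImp.uf-imp imp)
  ∗ UFEImp.au-imp imp ↦ map (au-ds ufe) (upTo n)
  ∗ is-dyn-array (unions ufe) (UFEImp.unions-imp imp)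

is-ufe-c : UFE × ℕ → UFECImp → Assn
is-ufe-c (ufe , n) imp =
    is-ufe (ufe , n) (ufe-imp imp)
  ∗ ∃ₐ λ uf → is-uf uf (uf-c-imp imp)
             ∗ ↑ (size uf ≡ n × (∀ {i} → i < n → ufa-rep-of uf i ≡ ufe-rep-of ufe i))

data Proc : Set → Set → Set₁ where
  rep-of         : Proc (UFImp × ℕ) ℕ
  compress       : Proc (UFImp × ℕ × ℕ) ⊤
  verts-from-rep : Proc (UFImp × ℕ × List ℕ) (List ℕ)
  find-newest    : Proc (UFEImp × ℕ × ℕ) (Maybe ℕ)
  explain′       : Proc (UFEImp × ℕ × ℕ) Proof

open HeapMonad Proc public using (Cmd; return; _>>=_; _>>_; raise; new; len; nth; upd; call)

infix 4 _≤?ᵒ_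
_≤?ᵒ_ = ≤₋-dec _≤?_

max : Maybe ℕ → Maybe ℕ → Maybe ℕ
max i j = if does (i ≤?ᵒ j) then j else i

decode-parent : ℕ → ℤ → ℕ
decode-parent i (+ p)    = p
decode-parent i -[1+ _ ] = i

parent-of-imp : UFImp → ℕ → Cmd ℕ
parent-of-imp a i = do
  v ← nth a i
  return (decode-parent i v)

rep-of-c-imp : UFImp → ℕ → Cmd ℕ
rep-of-c-imp a i = do
  r ← call rep-of (a , i)
  call compress (a , i , r)
  return r

from-just : ∀ {A} → Maybe A → Cmd A
from-just (just x) = return x
from-just nothing  = raise

lca-imp : UFImp → ℕ → ℕ → Cmd ℕ
lca-imp a x y = do
  xs ← call verts-from-rep (a , x , [])
  ys ← call verts-from-rep (a , y , [])
  from-just (last (longest-common-prefix _≟_ xs ys))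

explain-step : UFEImp → ℕ → ℕ → Maybe ℕ → Maybe ℕ → Cmd Proof
explain-step imp x y nx ny =
  if does (ny ≤?ᵒ nx)
    then (do i         ← from-just nx
             (ax , bx) ← nth us i
             p         ← call explain′ (imp , x , ax)
             q         ← call explain′ (imp , bx , y)
             return (p ▽ AssmP i ▽ q))
    else (do j         ← from-just ny
             (ay , by) ← nth us j
             p         ← call explain′ (imp , x , by)
             q         ← call explain′ (imp , ay , y)
             return (p ▽ SymP (AssmP j) ▽ q))
  where
  us : Array nat-pair
  us = proj₁ (UFEImp.unions-imp imp)

body : ∀ {A B} → Proc A B → A → Cmd B

body rep-of (a , i) = do
  p ← parent-of-imp a i
  if does (p ≟ i) then return i else call rep-of (a , p)

body compress (a , i , r) =
  if does (i ≟ r) then return tt else do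
    p ← parent-of-imp a i
    call compress (a , p , r)
    upd a i (+ r)

-- vs collects the vertices on the path already walked, so that the result
-- runs from the representative down to the starting point.
body verts-from-rep (a , i , vs) = do
  p ← parent-of-imp a i
  if does (p ≟ i) then return (i ∷ vs) else call verts-from-rep (a , p , i ∷ vs)

body find-newest (imp , y , x) =
  if does (y ≟ x) then return nothing else do
    i ← nth (UFEImp.au-imp imp) x
    p ← parent-of-imp (UFEImp.uf-imp imp) x
    j ← call find-newest (imp , y , p)
    return (max i j)

body explain′ (imp , x , y) =
  if does (x ≟ y) then return (ReflP x) else do
    c  ← lca-imp (UFEImp.uf-imp imp) x y
    nx ← call find-newest (imp , c , x)
    ny ← call find-newest (imp , c , y)
    explain-step imp x y nx ny

valid-imp : UFECImp → ℕ → ℕ → Cmd Bool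
valid-imp imp x y =
  if does (x ≟ y) then return true else do
    n ← len (uf-c-imp imp)
    if does ((x <? n) ×-dec (y <? n)) then
        (do rx ← rep-of-c-imp (uf-c-imp imp) x
            ry ← rep-of-c-imp (uf-c-imp imp) y
            return (does (rx ≟ ry)))
      else return false

explain-partial-imp : UFECImp → ℕ → ℕ → Cmd (Maybe Proof)
explain-partial-imp imp x y = do
  valid ← valid-imp imp x y
  if valid
    then (do p ← call explain′ (ufe-imp imp , x , y)
             return (just p))
    else return nothing

open HoareLogic Proc body public

-- Linking only changes a root, so the forest and the associated unions after a
-- prefix of the unions survive on all non-roots until the end. Let (a , b), with
-- index k and representatives ra, rb, be the last union of a prefix, and let it
-- be the one that connects x and y; say x was equivalent to a, and y to b. In the
-- final forest x then climbs through ra to rb by older edges and the edge from ra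
-- with index k, while y climbs to rb by older edges only. Hence rb is the lowest
-- common ancestor, k is the newest index and lies on the side of x, and explain′
-- splits at (a , b) just as explain does; the two recursive calls concern pairs
-- that are connected by the shorter prefix. Path compression redirects a non-root
-- to its own representative, so all representatives and class sizes are kept.

{-# OPTIONS --safe #-}
module Submission where

open import Data.Bool.Base using (true; false; if_then_else_)
open import Data.Integer.Base as ℤ using (ℤ; +_)
open import Data.List.Base
  using (List; []; _∷_; _++_; _∷ʳ_; _ʳ++_; reverse; length; map; filter; foldr;
         upTo; applyUpTo; take; last)
open import Data.List.Membership.Propositional using (_∈_)
open import Data.List.Membership.Propositional.Properties
  using (∈-++⁺ˡ; ∈-++⁺ʳ; ∈-++⁻; ∈-filter⁺; ∈-upTo⁺)
open import Data.List.Properties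
  using (++-ʳ++; ʳ++-defn; length-++; length-map; length-upTo; map-upTo; unfold-reverse)
open import Data.List.Relation.Unary.All as All using (All; []; _∷_)
open import Data.List.Relation.Unary.All.Properties using (all-upTo; ++⁺)
open import Data.List.Relation.Unary.Any using (here)
open import Data.List.Reverse using (Reverse; []; _∶_∶ʳ_; reverseView)
open import Data.Maybe.Base using (Maybe; just; nothing)
open import Data.Maybe.Relation.Unary.All as Maybe using (just; nothing)
open import Data.Nat.Base using (ℕ; zero; suc; _≤_; _<_; z≤n; s≤s)
open import Data.Nat.Properties
  using (_≟_; _<?_; <-irrefl; <-≤-trans; <⇒≤; m<n⇒m<1+n; n<1+n; +-comm)
open import Data.Product.Base using (∃-syntax; Σ-syntax; _×_; _,_; proj₁; proj₂; swap)
open import Data.Sum.Base as Sum using (_⊎_; inj₁; inj₂)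
open import Data.Unit.Base using (tt)
open import Function.Base using (_∘_; case_of_; id)
open import Relation.Binary.Construct.Add.Infimum.NonStrict _≤_ using (_≤₋_; ⊥₋≤_; [_])
open import Relation.Binary.Construct.Closure.Equivalence as EqC using ()
open import Relation.Binary.Construct.Closure.ReflexiveTransitive using (Star; ε; _◅_; _◅◅_)
open import Relation.Binary.Construct.Closure.Symmetric using (fwd; bwd)
open import Relation.Binary.Core using (_⇒_)
open import Relation.Binary.PropositionalEquality
  using (_≡_; _≢_; refl; sym; trans; cong; cong₂; subst; ≢-sym)
open import Relation.Nullary.Decidable
  using (Dec; yes; no; does; map′; dec-true; dec-false; _×-dec_)
open import Relation.Nullary.Negation using (¬_; contradiction)
open import Defs

module _ {a} {A : Set a} {P : Set} {x y : A} where

  if-yes : (P? : Dec P) → P → (if does P? then x else y) ≡ x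
  if-yes P? p rewrite dec-true P? p = refl

  if-no : (P? : Dec P) → ¬ P → (if does P? then x else y) ≡ y
  if-no P? ¬p rewrite dec-false P? ¬p = refl

-- Lists

module _ {A : Set} where

  !?⇒< : ∀ (xs : List A) i {v} → xs !? i ≡ just v → i < length xs
  !?⇒< (x ∷ xs) zero    _  = s≤s z≤n
  !?⇒< (x ∷ xs) (suc i) eq = s≤s (!?⇒< xs i eq)

  !?-≔-same : ∀ (xs : List A) i {v} → i < length xs → xs [ i ]≔ v !? i ≡ just v
  !?-≔-same (x ∷ xs) zero    _         = refl
  !?-≔-same (x ∷ xs) (suc i) (s≤s i<n) = !?-≔-same xs i i<n

  !?-≔-other : ∀ (xs : List A) i j {v} → i ≢ j → xs [ i ]≔ v !? j ≡ xs !? j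
  !?-≔-other []       _       _       _   = refl
  !?-≔-other (x ∷ xs) zero    zero    i≢j = contradiction refl i≢j
  !?-≔-other (x ∷ xs) zero    (suc j) _   = refl
  !?-≔-other (x ∷ xs) (suc i) zero    _   = refl
  !?-≔-other (x ∷ xs) (suc i) (suc j) i≢j = !?-≔-other xs i j (i≢j ∘ cong suc)

  !?-∷ʳ-last : ∀ (xs : List A) {v} → (xs ∷ʳ v) !? length xs ≡ just v
  !?-∷ʳ-last []       = refl
  !?-∷ʳ-last (x ∷ xs) = !?-∷ʳ-last xs

  !?-++ˡ : ∀ (xs {ys} : List A) i {v} → xs !? i ≡ just v → (xs ++ ys) !? i ≡ just v
  !?-++ˡ (x ∷ xs) zero    eq = eq
  !?-++ˡ (x ∷ xs) (suc i) eq = !?-++ˡ xs i eq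

  !?-take : ∀ k (xs : List A) i {v} → take k xs !? i ≡ just v → xs !? i ≡ just v
  !?-take (suc k) (x ∷ xs) zero    eq = eq
  !?-take (suc k) (x ∷ xs) (suc i) eq = !?-take k xs i eq

  !?-applyUpTo : ∀ (f : ℕ → A) {n i} → i < n → applyUpTo f n !? i ≡ just (f i)
  !?-applyUpTo f {suc n} {zero}  _         = refl
  !?-applyUpTo f {suc n} {suc i} (s≤s i<n) = !?-applyUpTo (f ∘ suc) i<n

  !?-map-upTo : ∀ (f : ℕ → A) {n i} → i < n → map f (upTo n) !? i ≡ just (f i)
  !?-map-upTo f {n} i<n rewrite map-upTo f n = !?-applyUpTo f i<n

  applyUpTo-cong : ∀ {f g : ℕ → A} n → (∀ {j} → j < n → f j ≡ g j) → applyUpTo f n ≡ applyUpTo g n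
  applyUpTo-cong zero    _   = refl
  applyUpTo-cong (suc n) f≗g = cong₂ _∷_ (f≗g (s≤s z≤n)) (applyUpTo-cong n (f≗g ∘ s≤s))

  applyUpTo-≔ : ∀ {f g : ℕ → A} n i {v} → g i ≡ v → (∀ {j} → j < n → i ≢ j → f j ≡ g j) →
    applyUpTo f n [ i ]≔ v ≡ applyUpTo g n
  applyUpTo-≔ zero    i       _  _   = refl
  applyUpTo-≔ (suc n) zero    eq f≗g =
    cong₂ _∷_ (sym eq) (applyUpTo-cong n (λ j<n → f≗g (s≤s j<n) (λ ())))
  applyUpTo-≔ (suc n) (suc i) eq f≗g =
    cong₂ _∷_ (f≗g (s≤s z≤n) (λ ()))
      (applyUpTo-≔ n i eq (λ j<n i≢j → f≗g (s≤s j<n) (λ { refl → i≢j refl })))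

  -- Serves path compression, where a single array write must turn the table of entries of the old
  -- forest into that of the new one.
  map-upTo-≔ : ∀ {f g : ℕ → A} n i {v} → g i ≡ v → (∀ {j} → j < n → i ≢ j → f j ≡ g j) →
    map f (upTo n) [ i ]≔ v ≡ map g (upTo n)
  map-upTo-≔ {f} {g} n i eq f≗g rewrite map-upTo f n | map-upTo g n = applyUpTo-≔ n i eq f≗g

  last-∷ʳ : ∀ (xs : List A) {x} → last (xs ∷ʳ x) ≡ just x
  last-∷ʳ []               = refl
  last-∷ʳ (x ∷ [])         = refl
  last-∷ʳ (x ∷ xs@(_ ∷ _)) = last-∷ʳ xs

  ʳ++-All⁺ : ∀ {P : A → Set} {xs ys} → All P xs → All P ys → All P (xs ʳ++ ys)
  ʳ++-All⁺ []         qs = qs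
  ʳ++-All⁺ (p ∷ ps) qs = ʳ++-All⁺ ps (p ∷ qs)

  length-filter-cong : ∀ {P Q : A → Set} (P? : ∀ x → Dec (P x)) (Q? : ∀ x → Dec (Q x)) {xs} →
    All (λ x → does (P? x) ≡ does (Q? x)) xs → length (filter P? xs) ≡ length (filter Q? xs)
  length-filter-cong P? Q? []                      = refl
  length-filter-cong P? Q? {x ∷ xs} (eq ∷ eqs) with does (P? x) | does (Q? x) | eq
  ... | true  | true  | refl = cong suc (length-filter-cong P? Q? eqs)
  ... | false | false | refl = length-filter-cong P? Q? eqs

lcp : List ℕ → List ℕ → List ℕ
lcp = longest-common-prefix _≟_

lcp-comm : ∀ xs ys → lcp xs ys ≡ lcp ys xs
lcp-comm []       []       = refl
lcp-comm []       (y ∷ ys) = refl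
lcp-comm (x ∷ xs) []       = refl
lcp-comm (x ∷ xs) (y ∷ ys) with x ≟ y
... | yes refl = cong (λ zs → if does (x ≟ x) then x ∷ zs else []) (lcp-comm xs ys)
... | no  x≢y  = trans (if-no (x ≟ y) x≢y) (sym (if-no (y ≟ x) (≢-sym x≢y)))

-- Right after `zs` the left list goes on with `r`, while the right one ends or goes on differently.
-- Avoidance is asked of all of `ys` because that condition is stable under reversing a path.
lcp-branch : ∀ zs {r xs ys} → All (_≢ r) ys → lcp (zs ++ r ∷ xs) (zs ++ ys) ≡ zs
lcp-branch []       []                = refl
lcp-branch []       {r} (y≢r ∷ _) = if-no (r ≟ _) (≢-sym y≢r)
lcp-branch (z ∷ zs) ys≢r          = trans (if-yes (z ≟ z) refl) (cong (z ∷_) (lcp-branch zs ys≢r))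

-- Paths to the root

-- vs lists the vertices from i (inclusive) up to j (exclusive); unlike in Star
-- (Parent l), the loop at a root is not a step.
data Path (l : List ℕ) : ℕ → List ℕ → ℕ → Set where
  []   : ∀ {i} → Path l i [] i
  step : ∀ {i vs j} → l ! i ≢ i → Path l (l ! i) vs j → Path l i (i ∷ vs) j

module _ {l : List ℕ} where

  star⇒path : ∀ {i j} → Star (Parent l) i j → ∃[ vs ] Path l i vs j
  star⇒path ε = [] , []
  star⇒path {i} (refl ◅ s) with l ! i ≟ i | star⇒path s
  -- This step is the loop at a root, so it is dropped.
  ... | yes eq  | vs , p = vs , subst (λ k → Path l k vs _) eq p
  ... | no  neq | vs , p = i ∷ vs , step neq p

  path⇒star : ∀ {i vs j} → Path l i vs j → Star (Parent l) i j
  path⇒star []         = ε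
  path⇒star (step _ p) = refl ◅ path⇒star p

  -- Each vertex has one parent, so the paths coincide step by step, and neither can stop first,
  -- since no step leaves a root.
  path-unique : ∀ {i vs ws j k} → Path l i vs j → Root l j → Path l i ws k → Root l k → j ≡ k
  path-unique []           _      []           _      = refl
  path-unique []           root-i (step neq _) _      = contradiction root-i neq
  path-unique (step neq _) _      []           root-i = contradiction root-i neq
  path-unique (step _ p)   root-j (step _ q)   root-k = path-unique p root-j q root-k

  path-nonroots : ∀ {i vs j} → Path l i vs j → All (λ v → l ! v ≢ v) vs
  path-nonroots []           = []
  path-nonroots (step neq p) = neq ∷ path-nonroots p

  path-avoids : ∀ {i vs j r} → Path l i vs j → Root l r → All (_≢ r) vs
  path-avoids p root-r = All.map (λ { neq refl → neq root-r }) (path-nonroots p)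

  path-++ : ∀ {i vs j ws k} → Path l i vs j → Path l j ws k → Path l i (vs ++ ws) k
  path-++ []           q = q
  path-++ (step neq p) q = step neq (path-++ p q)

  -- A path only takes steps out of non-roots. This carries paths of an earlier forest over to the
  -- final one.
  path-map : ∀ {l′ i vs j} → (∀ {v} → l ! v ≢ v → l′ ! v ≡ l ! v) → Path l i vs j → Path l′ i vs j
  path-map         agree []           = []
  path-map {l′} {i} agree (step neq p) =
    step (λ eq → neq (trans (sym (agree neq)) eq))
         (subst (λ k → Path l′ k _ _) (sym (agree neq)) (path-map agree p))

  last-verts : ∀ {i vs j} → Path l i vs j → last (j ∷ reverse vs) ≡ just i
  last-verts []                      = refl
  last-verts {i} {_ ∷ vs} {j} (step _ p) rewrite unfold-reverse i vs = last-∷ʳ (j ∷ reverse vs)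

  -- Follow the old path from `j`. If it never meets `i`, no step of it has changed. If it does, the
  -- new path goes from `i` straight to `r`; the old remainder from `i` to `k` is kept as evidence
  -- that `j` had the same root as `i`.
  path-redirect : ∀ {i r j vs k} → i < length l → r ≢ i → Root l k → Path l j vs k →
    let l′ = l [ i ]≔ r in
    (k ≢ i × ∃[ ws ] Path l′ j ws k) ⊎ ((∃[ ws ] Path l i ws k) × ∃[ ws ] Path l′ j ws r)
  path-redirect {i} {r} {j} i<n r≢i root-k p with i ≟ j
  ... | yes refl = inj₂ ((_ , p) , _ , step (r≢i ∘ trans (sym eq))
                      (subst (λ k → Path (l [ i ]≔ r) k [] r) (sym eq) []))
    where eq = !-≔-same l i i<n
  path-redirect i<n r≢i root-k [] | no i≢j = inj₁ (≢-sym i≢j , _ , [])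
  path-redirect {i} {r} {j} i<n r≢i root-k (step neq p) | no i≢j =
    Sum.map (λ (k≢i , _ , q) → k≢i , extend q) (λ (q , _ , q′) → q , extend q′)
      (path-redirect i<n r≢i root-k p)
    where
    eq = !-≔-other l i j {r} i≢j
    extend : ∀ {ws m} → Path (l [ i ]≔ r) (l ! j) ws m → ∃[ ws ] Path (l [ i ]≔ r) j ws m
    extend q = _ , step (neq ∘ trans (sym eq)) (subst (λ k → Path (l [ i ]≔ r) k _ _) (sym eq) q)


-- Representatives

module _ (uf : UF) where

  path-to-rep : ∀ {i} → i < size uf → ∃[ vs ] Path (parents uf) i vs (ufa-rep-of uf i)
  path-to-rep {i} i<n with i <? size uf
  ... | yes i<n′ = star⇒path (proj₁ (proj₂ (rooted uf i<n′)))
  ... | no  i≮n  = contradiction i<n i≮n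

  rep-unique : ∀ {i vs j} → i < size uf → Path (parents uf) i vs j → Root (parents uf) j →
    ufa-rep-of uf i ≡ j
  rep-unique i<n p root-j = path-unique (proj₂ (path-to-rep i<n)) (rep-root uf i<n) p root-j

  rep-of-root : ∀ {i} → i < size uf → Root (parents uf) i → ufa-rep-of uf i ≡ i
  rep-of-root i<n = rep-unique i<n []

-- Linking and path compression are both one redirection to a root: for linking `i` is itself a
-- root, for compression `r` is the root above `i`.
rep-redirect : ∀ uf uf′ {i r x} → parents uf′ ≡ parents uf [ i ]≔ r →
  i < size uf → Root (parents uf) r → r ≢ i → x < size uf →
  (ufa-rep-of uf x ≢ i × ufa-rep-of uf′ x ≡ ufa-rep-of uf x)
    ⊎ (ufa-rep-of uf x ≡ ufa-rep-of uf i × ufa-rep-of uf′ x ≡ r)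
rep-redirect uf uf′ {i} {r} {x} eq i<n root-r r≢i x<n =
  Sum.map
    (λ (k≢i , _ , q) → k≢i , rep-unique uf′ x<n′ (path q)
                                (root (trans (!-≔-other l i _ (≢-sym k≢i)) (rep-root uf x<n))))
    (λ ((_ , q) , _ , q′) → sym (rep-unique uf i<n q (rep-root uf x<n)) ,
                            rep-unique uf′ x<n′ (path q′)
                              (root (trans (!-≔-other l i r (≢-sym r≢i)) root-r)))
    (path-redirect i<n r≢i (rep-root uf x<n) (proj₂ (path-to-rep uf x<n)))
  where
  l = parents uf
  x<n′ : x < size uf′
  x<n′ = subst (x <_) (sym (trans (cong length eq) (length-≔ l i))) x<n
  path : ∀ {j vs k} → Path (l [ i ]≔ r) j vs k → Path (parents uf′) j vs k
  path = subst (λ l′ → Path l′ _ _ _) (sym eq)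
  root : ∀ {j} → Root (l [ i ]≔ r) j → Root (parents uf′) j
  root = subst (λ l′ → Root l′ _) (sym eq)

-- No cycle arises: `r` stays a root, as only the entry at `i` changes, so paths that meet `i` now
-- end at `r` and all others end where they did.
redirect : ∀ uf {i r} → i < size uf → r < size uf → Root (parents uf) r → r ≢ i → UF
redirect uf {i} {r} i<n r<n root-r r≢i = record
  { parents = l′ ; bounded = bounded′ ; rooted = rooted′ }
  where
  l  = parents uf
  l′ = l [ i ]≔ r
  bounded′ : ∀ {j} → j < length l′ → l′ ! j < length l′
  bounded′ {j} j<n rewrite length-≔ l i {r} with i ≟ j
  ... | yes refl rewrite !-≔-same l i {r} i<n = r<n
  ... | no  i≢j  rewrite !-≔-other l i j {r} i≢j = bounded uf j<n
  rooted′ : ∀ {j} → j < length l′ → ReachesRoot l′ j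
  rooted′ {j} j<n rewrite length-≔ l i {r}
    with path-redirect i<n r≢i (rep-root uf j<n) (proj₂ (path-to-rep uf j<n))
  ... | inj₁ (k≢i , _ , q) = _ , path⇒star q , trans (!-≔-other l i _ (≢-sym k≢i)) (rep-root uf j<n)
  ... | inj₂ (_ , _ , q)   = _ , path⇒star q , trans (!-≔-other l i r (≢-sym r≢i)) root-r

-- Unions

size-ufa-union : ∀ uf x y → size (ufa-union uf x y) ≡ size uf
size-ufa-union uf x y = go (x <? size uf) (y <? size uf)
  where
  go : ∀ dx dy → size (union-dec uf x y dx dy) ≡ size uf
  go (yes _) (yes _) = length-≔ (parents uf) _
  go (yes _) (no _)  = refl
  go (no _)  _       = refl

size-ufa-unions : ∀ uf us → size (ufa-unions uf us) ≡ size uf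
size-ufa-unions uf []             = refl
size-ufa-unions uf ((a , b) ∷ us) =
  trans (size-ufa-unions (ufa-union uf a b) us) (size-ufa-union uf a b)

ufa-unions-∷ʳ : ∀ uf us {a b} → ufa-unions uf (us ∷ʳ (a , b)) ≡ ufa-union (ufa-unions uf us) a b
ufa-unions-∷ʳ uf []             = refl
ufa-unions-∷ʳ uf ((a , b) ∷ us) = ufa-unions-∷ʳ (ufa-union uf a b) us

EffUnions-∷ʳ⁻ : ∀ uf us {a b} → EffUnions uf (us ∷ʳ (a , b)) →
  EffUnions uf us × EffUnion (ufa-unions uf us) a b
EffUnions-∷ʳ⁻ uf []             (e , _)  = tt , e
EffUnions-∷ʳ⁻ uf ((a , b) ∷ us) (e , es) =
  let es′ , e′ = EffUnions-∷ʳ⁻ (ufa-union uf a b) us es in (e , es′) , e′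

Field-bounded : ∀ uf {a} → Field (ufa-α uf) a → a < size uf
Field-bounded uf (_ , inj₁ (a<n , _))     = a<n
Field-bounded uf (_ , inj₂ (_ , a<n , _)) = a<n

module Union (uf : UF) {a b : ℕ} (e : EffUnion uf a b) where

  ra rb : ℕ
  ra = ufa-rep-of uf a
  rb = ufa-rep-of uf b

  uf′ : UF
  uf′ = ufa-union uf a b

  a<n : a < size uf
  a<n = Field-bounded uf (proj₁ e)

  b<n : b < size uf
  b<n = Field-bounded uf (proj₁ (proj₂ e))

  ra≢rb : ra ≢ rb
  ra≢rb = proj₂ (proj₂ e)

  parents-uf′ : parents uf′ ≡ parents uf [ ra ]≔ rb
  parents-uf′ = parents-ufa-union uf a<n b<n

  parent-ra : parents uf′ ! ra ≡ rb
  parent-ra = trans (cong (_! ra) parents-uf′) (!-≔-same (parents uf) ra (rep-bounded uf a<n))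

  parent-other : ∀ {i} → i ≢ ra → parents uf′ ! i ≡ parents uf ! i
  parent-other i≢ra = trans (cong (_! _) parents-uf′) (!-≔-other (parents uf) ra _ (≢-sym i≢ra))

  rep-union : ∀ {x} → x < size uf →
    (ufa-rep-of uf x ≢ ra × ufa-rep-of uf′ x ≡ ufa-rep-of uf x)
      ⊎ (ufa-rep-of uf x ≡ ra × ufa-rep-of uf′ x ≡ rb)
  rep-union x<n =
    -- The redirected index is `ra`, a root and therefore its own representative.
    Sum.map₂ (λ (eq , eq′) → trans eq (rep-of-root uf (rep-bounded uf a<n) (rep-root uf a<n)) , eq′)
      (rep-redirect uf uf′ parents-uf′ (rep-bounded uf a<n) (rep-root uf b<n) (≢-sym ra≢rb) x<n)

  shrink : ∀ {x} → x < size uf′ → x < size uf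
  shrink = subst (_ <_) (size-ufa-union uf a b)

  grow : ∀ {x} → x < size uf → x < size uf′
  grow = subst (_ <_) (sym (size-ufa-union uf a b))

  α-mono : ∀ {x y} → ufa-α uf x y → ufa-α uf′ x y
  α-mono (x<n , y<n , eq) with rep-union x<n | rep-union y<n
  ... | inj₁ (_ , ex)  | inj₁ (_ , ey)  = grow x<n , grow y<n , trans ex (trans eq (sym ey))
  ... | inj₂ (_ , ex)  | inj₂ (_ , ey)  = grow x<n , grow y<n , trans ex (sym ey)
  ... | inj₁ (neq , _) | inj₂ (ey , _)  = contradiction (trans eq ey) neq
  ... | inj₂ (ex , _)  | inj₁ (neq , _) = contradiction (trans (sym eq) ex) neq

  α-new : ufa-α uf′ a b
  α-new with rep-union a<n | rep-union b<n
  ... | inj₂ (_ , ea)  | inj₁ (_ , eb) = grow a<n , grow b<n , trans ea (sym eb)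
  ... | inj₁ (neq , _) | _             = contradiction refl neq
  ... | _              | inj₂ (eb , _) = contradiction (sym eb) ra≢rb

  -- The alternatives match the branches of `explain`: the union is irrelevant to the pair, is
  -- crossed from `a` to `b`, or is crossed from `b` to `a`.
  α-split : ∀ {x y} → ufa-α uf′ x y →
    ufa-α uf x y ⊎ (ufa-α uf x a × ufa-α uf b y) ⊎ (ufa-α uf x b × ufa-α uf a y)
  α-split (x<n′ , y<n′ , eq) with shrink x<n′ | shrink y<n′
  ... | x<n | y<n with rep-union x<n | rep-union y<n
  ... | inj₁ (_ , ex)  | inj₁ (_ , ey)  = inj₁ (x<n , y<n , trans (sym ex) (trans eq ey))
  ... | inj₂ (ex , _)  | inj₂ (ey , _)  = inj₁ (x<n , y<n , trans ex (sym ey))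
  -- The representative of `x` moved to `rb` and that of `y` did not move, so `y` had representative
  -- `rb` all along.
  ... | inj₂ (ex , ex′) | inj₁ (_ , ey) =
    inj₂ (inj₁ ((x<n , a<n , ex) , (b<n , y<n , trans (sym ex′) (trans eq ey))))
  ... | inj₁ (_ , ex) | inj₂ (ey , ey′) =
    inj₂ (inj₂ ((x<n , b<n , trans (sym ex) (trans eq ey′)) , (a<n , y<n , sym ey)))

-- The represented equivalence relation

module _ (uf : UF) where

  union-related : ∀ {us} → Reverse us → EffUnions uf us → ∀ {x y} → (x , y) ∈ us →
    ufa-α (ufa-unions uf us) x y
  union-related (us ∶ rs ∶ʳ (a , b)) es xy∈us rewrite ufa-unions-∷ʳ uf us {a} {b}
    with EffUnions-∷ʳ⁻ uf us es | ∈-++⁻ us xy∈us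
  ... | es′ , e | inj₁ xy∈us′      = Union.α-mono (ufa-unions uf us) e (union-related rs es′ xy∈us′)
  ... | es′ , e | inj₂ (here refl) = Union.α-new (ufa-unions uf us) e

  α⇒equivcl : (ufa-α uf ⇒ _≡_) → ∀ {us} → Reverse us → EffUnions uf us → ∀ {x y} →
    ufa-α (ufa-unions uf us) x y → equivcl us x y
  α⇒equivcl discrete [] _ α = subst (equivcl [] _) (discrete α) ε
  α⇒equivcl discrete (us ∶ rs ∶ʳ (a , b)) es α rewrite ufa-unions-∷ʳ uf us {a} {b} =
    let es′ , e = EffUnions-∷ʳ⁻ uf us es
        old : ufa-α (ufa-unions uf us) ⇒ equivcl (us ∷ʳ (a , b))
        old = EqC.map ∈-++⁺ˡ ∘ α⇒equivcl discrete rs es′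
        new = ∈-++⁺ʳ us (here refl)
    in case Union.α-split (ufa-unions uf us) e α of λ
      { (inj₁ α′)               → old α′
      ; (inj₂ (inj₁ (α₁ , α₂))) → old α₁ ◅◅ fwd new ◅ old α₂
      ; (inj₂ (inj₂ (α₁ , α₂))) → old α₁ ◅◅ bwd new ◅ old α₂
      }

  -- The closure is reflexive on all numbers, whereas `ufa-α` only relates elements below the size;
  -- hence the separate alternative of equality, which `valid-imp` tests first as well.
  equivcl⇒≡⊎α : ∀ {us} → EffUnions uf us → ∀ {x y} → equivcl us x y →
    x ≡ y ⊎ ufa-α (ufa-unions uf us) x y
  equivcl⇒≡⊎α es ε = inj₁ refl
  equivcl⇒≡⊎α {us} es (fwd m ◅ s) with union-related (reverseView us) es m | equivcl⇒≡⊎α es s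
  ... | α                 | inj₁ refl            = inj₂ α
  ... | x<n , _ , eq | inj₂ (_ , y<n , eq′) = inj₂ (x<n , y<n , trans eq eq′)
  equivcl⇒≡⊎α {us} es (bwd m ◅ s) with union-related (reverseView us) es m | equivcl⇒≡⊎α es s
  ... | x<n , y<n , eq | inj₁ refl            = inj₂ (y<n , x<n , sym eq)
  ... | _ , x<n , eq | inj₂ (_ , y<n , eq′) = inj₂ (x<n , y<n , trans (sym eq) eq′)

  -- This covers `x` outside the element set too: comparing a representative with itself takes the
  -- first branch at every rollback, whatever default value it has there.
  explain-rev-refl : ∀ {us} (rs : Reverse us) x → explain-rev uf rs x x ≡ ReflP x
  explain-rev-refl []              x = refl
  explain-rev-refl (us ∶ rs ∶ʳ _) x =
    trans (if-yes (ufa-rep-of (ufa-unions uf us) x ≟ _) refl) (explain-rev-refl rs x)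

-- Lets the specification branch on any decision of the condition, in particular on the one
-- extracted from the run of the validity check.
explain-partial-≡ : ∀ ufe {x y} (d : Dec (x ≡ y ⊎ ufa-α (uf-ds ufe) x y)) →
  explain-partial ufe x y ≡ (if does d then just (explain ufe x y) else nothing)
explain-partial-≡ ufe {x} {y} d with equivcl? (unions ufe) x y
... | yes eqv = sym (if-yes d (equivcl⇒≡⊎α (uf-init ufe) (eff ufe) eqv))
... | no ¬eqv = sym (if-no d λ
  { (inj₁ refl) → ¬eqv ε
  ; (inj₂ α)    → ¬eqv (α⇒equivcl (uf-init ufe) (discrete ufe) (reverseView (unions ufe)) (eff ufe) α) })

-- Runs on arrays

module _ {A : Set} {P : Set} {c c′ : Cmd A} {h h′ : Heap} {r : A} where

  ⇓then : (P? : Dec P) → P → c , h ⇓ r , h′ → (if does P? then c else c′) , h ⇓ r , h′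
  ⇓then P? p run = subst (λ d → d , h ⇓ r , h′) (sym (if-yes P? p)) run

  ⇓else : (P? : Dec P) → ¬ P → c′ , h ⇓ r , h′ → (if does P? then c else c′) , h ⇓ r , h′
  ⇓else P? ¬p run = subst (λ d → d , h ⇓ r , h′) (sym (if-no P? ¬p)) run

⇓from-just : ∀ {A : Set} {m : Maybe A} {x h} → m ≡ just x → from-just m , h ⇓ x , h
⇓from-just refl = ⇓return

uf-entries : UF → List ℤ
uf-entries uf = map (uf-entry uf) (upTo (size uf))

length-uf-entries : ∀ uf → length (uf-entries uf) ≡ size uf
length-uf-entries uf = trans (length-map (uf-entry uf) (upTo (size uf))) (length-upTo (size uf))

-- The class of `i` contains `i`. Positivity matters for decoding: the negative of size 0 would be
-- `+ 0`, which reads as a link to index 0.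
class-size-pos : ∀ uf {i} → i < size uf → ∃[ k ] class-size uf i ≡ suc k
class-size-pos uf {i} i<n
  with filter (λ j → ufa-rep-of uf j ≟ ufa-rep-of uf i) (upTo (size uf))
     | ∈-filter⁺ (λ j → ufa-rep-of uf j ≟ ufa-rep-of uf i) (∈-upTo⁺ i<n) refl
... | _ ∷ js | _ = length js , refl

decode-entry : ∀ uf {i} → i < size uf → decode-parent i (uf-entry uf i) ≡ parents uf ! i
decode-entry uf {i} i<n with parents uf ! i ≟ i
... | no  neq = cong (decode-parent i) (if-no (parents uf ! i ≟ i) neq)
... | yes eq  with class-size-pos uf i<n
...   | k , pos =
  trans (cong (decode-parent i)
               (trans (if-yes (parents uf ! i ≟ i) eq) (cong (λ m → ℤ.- (+ m)) pos)))
        (sym eq)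

module _ (uf : UF) {arr : UFImp} {h : Heap} (cell : h !? addr arr ≡ just (int , uf-entries uf)) where

  private
    l = parents uf

  run-parent : ∀ {i} → i < size uf → parent-of-imp arr i , h ⇓ l ! i , h
  run-parent {i} i<n =
    subst (λ r → parent-of-imp arr i , h ⇓ r , h) (decode-entry uf i<n)
      (⇓bind (⇓nth cell (!?-map-upTo (uf-entry uf) i<n)) ⇓return)

  run-rep-of : ∀ {i vs j} → i < size uf → Path l i vs j → Root l j →
    call rep-of (arr , i) , h ⇓ j , h
  run-rep-of i<n []           root-j =
    ⇓call (⇓bind (run-parent i<n) (⇓then (_ ≟ _) root-j ⇓return))
  run-rep-of i<n (step neq p) root-j =
    ⇓call (⇓bind (run-parent i<n) (⇓else (_ ≟ _) neq (run-rep-of (bounded uf i<n) p root-j)))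

  run-verts-from-rep : ∀ {i vs j acc} → i < size uf → Path l i vs j → Root l j →
    call verts-from-rep (arr , i , acc) , h ⇓ j ∷ vs ʳ++ acc , h
  run-verts-from-rep i<n []           root-j =
    ⇓call (⇓bind (run-parent i<n) (⇓then (_ ≟ _) root-j ⇓return))
  run-verts-from-rep i<n (step neq p) root-j =
    ⇓call (⇓bind (run-parent i<n)
      (⇓else (_ ≟ _) neq (run-verts-from-rep (bounded uf i<n) p root-j)))

  -- Both vertex lists begin with the descent from the root to `c`, and the last hypothesis makes
  -- them part there. It quantifies over `zs` because that descent is only obtained inside the
  -- proof.
  run-lca : ∀ {x y c vs ws} → x < size uf → y < size uf → c < size uf →
    Path l x vs c → Path l y ws c →
    (∀ zs → lcp (zs ++ (vs ʳ++ [])) (zs ++ (ws ʳ++ [])) ≡ zs) →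
    lca-imp arr x y , h ⇓ c , h
  run-lca {x} {y} {c} {vs} {ws} x<n y<n c<n p q branch =
    let us , path = path-to-rep uf c<n
        root      = rep-root uf c<n
        -- As `us` runs from `c` up to the root exclusively, `zs` includes both ends and its last
        -- entry is `c`, even if `c` is the root.
        zs        = ufa-rep-of uf c ∷ reverse us
    in  ⇓bind (run-verts-from-rep x<n (path-++ p path) root)
       (⇓bind (run-verts-from-rep y<n (path-++ q path) root)
              (⇓from-just (trans
                (cong last (trans (cong₂ (λ xs ys → lcp (_ ∷ xs) (_ ∷ ys)) (verts vs us) (verts ws us))
                                  (branch zs)))
                (last-verts path))))
    where
    verts : ∀ vs us → (vs ++ us) ʳ++ [] ≡ reverse us ++ (vs ʳ++ [])
    verts vs us = trans (++-ʳ++ vs) (ʳ++-defn us)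

-- Newest unions

Older : ℕ → Maybe ℕ → Set
Older k = Maybe.All (_< k)

older⇒≤₋ : ∀ {k m} → Older k m → m ≤₋ just k
older⇒≤₋ nothing    = ⊥₋≤ _
older⇒≤₋ (just t<k) = [ <⇒≤ t<k ]

older⇒≰₋ : ∀ {k m} → Older k m → ¬ (just k ≤₋ m)
older⇒≰₋ (just t<k) [ k≤t ] = <-irrefl refl (<-≤-trans t<k k≤t)

max-older : ∀ {k m m′} → Older k m → Older k m′ → Older k (max m m′)
max-older {m = m} {m′} o o′ with does (m ≤?ᵒ m′)
... | true  = o′
... | false = o

max-newestˡ : ∀ {k m} → Older k m → max (just k) m ≡ just k
max-newestˡ o = if-no (just _ ≤?ᵒ _) (older⇒≰₋ o)

max-newestʳ : ∀ {k m} → Older k m → max m (just k) ≡ just k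
max-newestʳ o = if-yes (_ ≤?ᵒ just _) (older⇒≤₋ o)

newest : (ℕ → Maybe ℕ) → List ℕ → Maybe ℕ
newest au = foldr (λ v m → max (au v) m) nothing

newest-older : ∀ {k au vs} → All (Older k ∘ au) vs → Older k (newest au vs)
newest-older []       = nothing
newest-older (o ∷ os) = max-older o (newest-older os)

-- This is the climb from the side of `a`: older links up to `ra`, then the link of the union
-- itself, whose index beats them all.
newest-∷ʳ : ∀ {k au vs v} → All (Older k ∘ au) vs → au v ≡ just k → newest au (vs ∷ʳ v) ≡ just k
newest-∷ʳ {k}      []       eq = trans (cong (λ m → max m nothing) eq) (max-newestˡ {k} nothing)
newest-∷ʳ {au = au} (_∷_ {x = v} o os) eq =
  trans (cong (max (au v)) (newest-∷ʳ os eq)) (max-newestʳ o)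

module _ (uf : UF) (au : ℕ → Maybe ℕ) {imp : UFEImp} {h : Heap}
         (uf-cell : h !? addr (UFEImp.uf-imp imp) ≡ just (int , uf-entries uf))
         (au-cell : h !? addr (UFEImp.au-imp imp) ≡ just (maybe-nat , map au (upTo (size uf)))) where

  -- The program stops at its first visit to `j`, so the path must not meet `j` before its end.
  run-find-newest : ∀ {i vs j} → i < size uf → Path (parents uf) i vs j → All (_≢ j) vs →
    call find-newest (imp , j , i) , h ⇓ newest au vs , h
  run-find-newest {i} i<n []     []           = ⇓call (⇓then (i ≟ i) refl ⇓return)
  run-find-newest i<n (step _ p) (i≢j ∷ neqs) =
    ⇓call (⇓else (_ ≟ _) (≢-sym i≢j)
      (⇓bind (⇓nth au-cell (!?-map-upTo au i<n))
      (⇓bind (run-parent uf uf-cell i<n)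
      (⇓bind (run-find-newest (bounded uf i<n) p neqs)
       ⇓return))))

-- The recursion of explain′

au-rev-older : ∀ uf {us} (rs : Reverse us) i → Older (length us) (au-rev uf rs i)
au-rev-older uf []                   i = nothing
au-rev-older uf (us ∶ rs ∶ʳ (a , b)) i
  rewrite length-++ us {(a , b) ∷ []} | +-comm (length us) 1
  with does (i ≟ ufa-rep-of (ufa-unions uf us) a)
... | true  = just (n<1+n (length us))
... | false = Maybe.map m<n⇒m<1+n (au-rev-older uf rs i)

module _ (ufe : UFE) where

  private
    uf₀ = uf-init ufe
    l   = parents (uf-ds ufe)

  -- The state after the unions us is an initial stage of ufe; linking only ever
  -- changes roots, so the final data structure agrees with it on its non-roots.
  record Stage {us : List (ℕ × ℕ)} (rs : Reverse us) : Set where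
    field
      eff-unions    : EffUnions uf₀ us
      parents-agree : ∀ {i} → parents (ufa-unions uf₀ us) ! i ≢ i →
                      l ! i ≡ parents (ufa-unions uf₀ us) ! i
      au-agrees     : ∀ {i} → parents (ufa-unions uf₀ us) ! i ≢ i → au-ds ufe i ≡ au-rev uf₀ rs i
      unions-agree  : ∀ {t p} → us !? t ≡ just p → unions ufe !? t ≡ just p

  open Stage

  final-stage : Stage (reverseView (unions ufe))
  final-stage = record
    { eff-unions    = eff ufe
    ; parents-agree = λ _ → refl
    ; au-agrees     = λ _ → refl
    ; unions-agree  = id
    }

  module LastUnion {us : List (ℕ × ℕ)} {a b : ℕ} (rs : Reverse us)
                   (stage : Stage (us ∶ rs ∶ʳ (a , b))) where

    uf : UF
    uf = ufa-unions uf₀ us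

    effective : EffUnion uf a b
    effective = proj₂ (EffUnions-∷ʳ⁻ uf₀ us (eff-unions stage))

    open Union uf effective public

    private
      k = length us

      agree : ∀ {i p} → parents uf′ ! i ≡ p → p ≢ i →
        l ! i ≡ p × au-ds ufe i ≡ au-rev uf₀ (us ∶ rs ∶ʳ (a , b)) i
      agree {i} refl neq rewrite sym (ufa-unions-∷ʳ uf₀ us {a} {b}) =
        parents-agree stage neq , au-agrees stage neq

      ≢ra : ∀ {i} → parents uf ! i ≢ i → i ≢ ra
      ≢ra neq refl = neq (rep-root uf a<n)

    -- A non-root before the union differs from `ra`, so the link leaves its parent and associated
    -- union alone. It is still a non-root afterwards, where the given stage applies.
    rolled-back : Stage rs
    rolled-back = record
      { eff-unions    = proj₁ (EffUnions-∷ʳ⁻ uf₀ us (eff-unions stage))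
      ; parents-agree = λ neq → proj₁ (agree (parent-other (≢ra neq)) neq)
      ; au-agrees     = λ neq → trans (proj₂ (agree (parent-other (≢ra neq)) neq))
                                      (if-no (_ ≟ ra) (≢ra neq))
      ; unions-agree  = λ {t} → unions-agree stage ∘ !?-++ˡ us t
      }

    -- With this union `ra` stops being a root, so its parent and its index are final.
    linked-parent : l ! ra ≡ rb
    linked-parent = proj₁ (agree parent-ra (≢-sym ra≢rb))

    linked-au : au-ds ufe ra ≡ just k
    linked-au = trans (proj₂ (agree parent-ra (≢-sym ra≢rb))) (if-yes (ra ≟ ra) refl)

    linked-union : unions ufe !? k ≡ just (a , b)
    linked-union = unions-agree stage (!?-∷ʳ-last us)

    -- ra and rb are roots before the union, so they do not occur on these paths.
    path-before : ∀ {x c} → x < size uf → ufa-rep-of uf x ≡ c → ∃[ vs ]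
      Path l x vs c × All (Older k ∘ au-ds ufe) vs × All (_≢ ra) vs × All (_≢ rb) vs
    path-before x<n refl =
      let vs , p = path-to-rep uf x<n in
      vs , path-map (parents-agree rolled-back) p ,
      All.map (λ neq → subst (Older k) (sym (au-agrees rolled-back neq)) (au-rev-older uf₀ rs _))
              (path-nonroots p) ,
      path-avoids p (rep-root uf a<n) , path-avoids p (rep-root uf b<n)

-- Stated by lookups in the whole heap, in the form in which the read-only program `explain′` uses
-- them. `us-agree` goes one way, as the backing array may have unoccupied cells after the unions.
record Represents (ufe : UFE) (imp : UFEImp) (h : Heap) : Set where
  field
    uf-cell  : h !? addr (UFEImp.uf-imp imp) ≡ just (int , uf-entries (uf-ds ufe))
    au-cell  : h !? addr (UFEImp.au-imp imp) ≡
               just (maybe-nat , map (au-ds ufe) (upTo (size (uf-ds ufe))))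
    pairs    : List (ℕ × ℕ)
    us-cell  : h !? addr (proj₁ (UFEImp.unions-imp imp)) ≡ just (nat-pair , pairs)
    us-agree : ∀ {t p} → unions ufe !? t ≡ just p → pairs !? t ≡ just p

module _ (ufe : UFE) {imp : UFEImp} {h : Heap} (reps : Represents ufe imp h) where

  open Represents reps

  private
    arr = UFEImp.uf-imp imp
    uf₀ = uf-init ufe

  -- Here `u` is on the side of `a` and `v` on that of `b`. Both argument orders of the lowest
  -- common ancestor are supplied, so that the union can be crossed in either direction.
  run-branches : ∀ {us a b} (rs : Reverse us) (stage : Stage ufe (us ∶ rs ∶ʳ (a , b))) →
    let uf = ufa-unions uf₀ us; rb = ufa-rep-of uf b in
    ∀ {u v} → ufa-α uf u a → ufa-α uf b v →
    ∃[ m ] Older (length us) m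
      × (lca-imp arr u v , h ⇓ rb , h)
      × (lca-imp arr v u , h ⇓ rb , h)
      × (call find-newest (imp , rb , u) , h ⇓ just (length us) , h)
      × (call find-newest (imp , rb , v) , h ⇓ m , h)
  run-branches {us} {a} {b} rs stage {u} {v} (u<n , _ , u~a) (_ , v<n , b~v) =
    let vs , p , older-vs , _ , vs≢rb      = path-before u<n u~a
        ws , q , older-ws , ws≢ra , ws≢rb = path-before v<n (sym b~v)
        p′ = path-++ p ra→rb
        -- Going down from `rb`, the list for `u` continues with `ra`, which the path of `v` avoids.
        branch zs = trans (cong (λ us → lcp (zs ++ us) (zs ++ (ws ʳ++ []))) (++-ʳ++ vs))
                          (lcp-branch zs (ʳ++-All⁺ ws≢ra []))
    in newest (au-ds ufe) ws , newest-older older-ws ,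
       run-lca (uf-ds ufe) uf-cell (final u<n) (final v<n) (final rb<n) p′ q branch ,
       run-lca (uf-ds ufe) uf-cell (final v<n) (final u<n) (final rb<n) q p′
         (λ zs → trans (lcp-comm (zs ++ _) (zs ++ _)) (branch zs)) ,
       subst (λ m → call find-newest (imp , rb , u) , h ⇓ m , h) (newest-∷ʳ older-vs linked-au)
         (run-find-newest (uf-ds ufe) (au-ds ufe) uf-cell au-cell (final u<n) p′
           (++⁺ vs≢rb (ra≢rb ∷ []))) ,
       run-find-newest (uf-ds ufe) (au-ds ufe) uf-cell au-cell (final v<n) q ws≢rb
    where
    open LastUnion ufe rs stage
    rb<n : rb < size uf
    rb<n = rep-bounded uf b<n
    final : ∀ {i} → i < size uf → i < size (uf-ds ufe)
    final = subst (_ <_) (trans (size-ufa-unions uf₀ us) (sym (size-ufa-unions uf₀ (unions ufe))))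
    ra→rb : Path (parents (uf-ds ufe)) ra (ra ∷ []) rb
    ra→rb = step (λ eq → ra≢rb (trans (sym eq) linked-parent))
                 (subst (λ i → Path (parents (uf-ds ufe)) i [] rb) (sym linked-parent) [])

  run-explain′-refl : ∀ {x} → call explain′ (imp , x , x) , h ⇓ ReflP x , h
  run-explain′-refl {x} = ⇓call (⇓then (x ≟ x) refl ⇓return)

  -- The induction shortens the prefix while the program keeps reading the final arrays, hence the
  -- generalisation to all stages. Where `explain` merely rolls back, the induction hypothesis is
  -- already the run of the same call.
  run-explain′ : ∀ {us} (rs : Reverse us) → Stage ufe rs → ∀ {x y} → ufa-α (ufa-unions uf₀ us) x y →
    call explain′ (imp , x , y) , h ⇓ explain-rev uf₀ rs x y , h
  run-explain′ [] _ α with discrete ufe α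
  ... | refl = run-explain′-refl
  run-explain′ (us ∶ rs ∶ʳ (a , b)) stage {x} {y} α =
    case α-split (subst (λ uf → ufa-α uf x y) (ufa-unions-∷ʳ uf₀ us) α) of λ
      { (inj₁ α′@(_ , _ , x~y)) →
          ⇓result (if-yes (rep x ≟ rep y) x~y) (run-explain′ rs rolled-back α′)
      ; (inj₂ (inj₁ (x~a@(_ , _ , rx≡ra) , b~y@(_ , _ , rb≡ry)))) →
          let rx≢ry = λ eq → ra≢rb (trans (sym rx≡ra) (trans eq (sym rb≡ry)))
              m , older , lca , _ , newest-x , newest-y = run-branches rs stage x~a b~y
          in ⇓result (trans (if-no (rep x ≟ rep y) rx≢ry) (if-yes (rep x ≟ rep a) rx≡ra))
               (⇓call (⇓else (x ≟ y) (rx≢ry ∘ cong rep)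
                 (⇓bind lca (⇓bind newest-x (⇓bind newest-y
                   (⇓then (m ≤?ᵒ just (length us)) (older⇒≤₋ older)
                     (⇓bind ⇓return (⇓bind (⇓nth us-cell (us-agree linked-union))
                       (⇓bind (run-explain′ rs rolled-back x~a)
                         (⇓bind (run-explain′ rs rolled-back b~y) ⇓return))))))))))
      ; (inj₂ (inj₂ (x~b@(x<n , _ , rx≡rb) , a~y@(_ , y<n , ra≡ry)))) →
          let rx≢ry = λ eq → ra≢rb (trans ra≡ry (trans (sym eq) rx≡rb))
              -- The roles are exchanged: `y` is on the side of `a`, so the newest index is found
              -- from `y`, and being strictly larger it makes the test `ny ≤?ᵒ nx` fail.
              m , older , _ , lca , newest-y , newest-x =
                run-branches rs stage (y<n , a<n , sym ra≡ry) (b<n , x<n , sym rx≡rb)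
          in ⇓result (trans (if-no (rep x ≟ rep y) rx≢ry)
                            (if-no (rep x ≟ rep a) (λ eq → ra≢rb (trans (sym eq) rx≡rb))))
               (⇓call (⇓else (x ≟ y) (rx≢ry ∘ cong rep)
                 (⇓bind lca (⇓bind newest-x (⇓bind newest-y
                   (⇓else (just (length us) ≤?ᵒ m) (older⇒≰₋ older)
                     (⇓bind ⇓return (⇓bind (⇓nth us-cell (us-agree linked-union))
                       (⇓bind (run-explain′ rs rolled-back x~b)
                         (⇓bind (run-explain′ rs rolled-back a~y) ⇓return))))))))))
      }
    where
    open LastUnion ufe rs stage
    rep : ℕ → ℕ
    rep = ufa-rep-of uf
    ⇓result : ∀ {p q} → p ≡ q → call explain′ (imp , x , y) , h ⇓ q , h →
              call explain′ (imp , x , y) , h ⇓ p , h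
    ⇓result refl run = run

-- Path compression

SameReps : UF → UF → Set
SameReps uf uf′ = size uf′ ≡ size uf × (∀ {i} → i < size uf → ufa-rep-of uf′ i ≡ ufa-rep-of uf i)

same-reps-trans : ∀ {uf uf′ uf″} → SameReps uf uf′ → SameReps uf′ uf″ → SameReps uf uf″
same-reps-trans (size≡ , reps≡) (size≡′ , reps≡′) =
  trans size≡′ size≡ , λ i<n → trans (reps≡′ (subst (_ <_) (sym size≡) i<n)) (reps≡ i<n)

-- Root entries store class sizes, so these must survive compression for one write to produce the
-- complete new array.
class-size-cong : ∀ uf uf′ → SameReps uf uf′ → ∀ {i} → i < size uf → class-size uf i ≡ class-size uf′ i
class-size-cong uf uf′ (size≡ , reps≡) {i} i<n = trans
  (length-filter-cong same? same?′
    (All.map (λ j<n → cong₂ (λ r r′ → does (r ≟ r′)) (sym (reps≡ j<n)) (sym (reps≡ i<n)))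
             (all-upTo (size uf))))
  (cong (λ n → length (filter same?′ (upTo n))) (sym size≡))
  where
  same? : ∀ j → Dec (ufa-rep-of uf j ≡ ufa-rep-of uf i)
  same? j = ufa-rep-of uf j ≟ ufa-rep-of uf i
  same?′ : ∀ j → Dec (ufa-rep-of uf′ j ≡ ufa-rep-of uf′ i)
  same?′ j = ufa-rep-of uf′ j ≟ ufa-rep-of uf′ i

module Compress (uf : UF) {i r : ℕ} (i<n : i < size uf) (rep-i : ufa-rep-of uf i ≡ r) (r≢i : r ≢ i) where

  private
    r<n : r < size uf
    r<n = subst (_< size uf) rep-i (rep-bounded uf i<n)

    root-r : Root (parents uf) r
    root-r = subst (Root (parents uf)) rep-i (rep-root uf i<n)

  compressed : UF
  compressed = redirect uf i<n r<n root-r r≢i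

  compressed-same-reps : SameReps uf compressed
  compressed-same-reps = length-≔ (parents uf) i , λ {x} x<n →
    case rep-redirect uf compressed refl i<n root-r r≢i x<n of λ
      { (inj₁ (_ , eq))  → eq
      ; (inj₂ (eq , eq′)) → trans eq′ (sym (trans eq rep-i))
      }

  entries-compressed : uf-entries uf [ i ]≔ (+ r) ≡ uf-entries compressed
  entries-compressed = trans
    (map-upTo-≔ (size uf) i
      (trans (if-no (_ ≟ i) (r≢i ∘ trans (sym parent-i))) (cong +_ parent-i))
      (λ {j} j<n i≢j → cong₂ (λ p s → if does (p ≟ j) then ℤ.- (+ s) else (+ p))
        (sym (!-≔-other (parents uf) i j i≢j))
        (class-size-cong uf compressed compressed-same-reps j<n)))
    (cong (λ n → map (uf-entry compressed) (upTo n)) (sym (proj₁ compressed-same-reps)))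
    where
    parent-i : parents compressed ! i ≡ r
    parent-i = !-≔-same (parents uf) i i<n

record Compresses (arr : UFImp) (uf : UF) (h h′ : Heap) : Set where
  field
    {new-uf}  : UF
    same-reps : SameReps uf new-uf
    new-cell  : h′ !? addr arr ≡ just (int , uf-entries new-uf)
    untouched : ∀ {a} → a ≢ addr arr → h′ !? a ≡ h !? a

open Compresses

module _ {arr : UFImp} where

  compresses-refl : ∀ {uf h} → h !? addr arr ≡ just (int , uf-entries uf) → Compresses arr uf h h
  compresses-refl {uf} cell = record
    { new-uf = uf ; same-reps = refl , λ _ → refl ; new-cell = cell ; untouched = λ _ → refl }

  compresses-trans : ∀ {uf h h′ h″} (c : Compresses arr uf h h′) →
    Compresses arr (new-uf c) h′ h″ → Compresses arr uf h h″
  compresses-trans {uf} c c′ = record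
    { new-uf    = new-uf c′
    ; same-reps = same-reps-trans {uf} {new-uf c} {new-uf c′} (same-reps c) (same-reps c′)
    ; new-cell  = new-cell c′
    ; untouched = λ a≢ → trans (untouched c′ a≢) (untouched c a≢)
    }

  run-compress : ∀ uf {h i vs r} → h !? addr arr ≡ just (int , uf-entries uf) → i < size uf →
    Path (parents uf) i vs r → Root (parents uf) r →
    ∃[ h′ ] (call compress (arr , i , r) , h ⇓ tt , h′) × Compresses arr uf h h′
  run-compress uf {h} {i} cell i<n [] _ =
    h , ⇓call (⇓then (i ≟ i) refl ⇓return) , compresses-refl cell
  run-compress uf {h} {i} {_} {r} cell i<n (step neq p) root-r =
    let h₁ , run , c = run-compress uf cell (bounded uf i<n) p root-r
        i≢r          = λ i≡r → neq (subst (Root (parents uf)) (sym i≡r) root-r)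
        i<n₁         = subst (i <_) (sym (proj₁ (same-reps c))) i<n
        -- The recursive call has already changed the forest above `i`, but not the representatives,
        -- so `r` is still the root to redirect to.
        rep-i        = trans (proj₂ (same-reps c) i<n) (rep-unique uf i<n (step neq p) root-r)
        open Compress (new-uf c) i<n₁ rep-i (≢-sym i≢r)
        bound        = subst (i <_) (sym (length-uf-entries (new-uf c))) i<n₁
    in _ ,
       ⇓call (⇓else (i ≟ r) i≢r
         (⇓bind (run-parent uf cell i<n) (⇓bind run (⇓upd (new-cell c) bound)))) ,
       compresses-trans c (record
         { new-uf    = compressed
         ; same-reps = compressed-same-reps
         ; new-cell  = trans (!?-≔-same h₁ (addr arr) (!?⇒< h₁ (addr arr) (new-cell c)))
                             (cong (λ es → just (int , es)) entries-compressed)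
         ; untouched = λ a≢ → !?-≔-other h₁ (addr arr) _ (≢-sym a≢)
         })

  run-rep-of-c : ∀ uf {h i} → h !? addr arr ≡ just (int , uf-entries uf) → i < size uf →
    ∃[ h′ ] (rep-of-c-imp arr i , h ⇓ ufa-rep-of uf i , h′) × Compresses arr uf h h′
  run-rep-of-c uf cell i<n =
    let _ , path     = path-to-rep uf i<n
        h′ , run , c = run-compress uf cell i<n path (rep-root uf i<n)
    in h′ , ⇓bind (run-rep-of uf cell i<n path (rep-root uf i<n)) (⇓bind run ⇓return) , c

-- The result is presented as `does` of a decision, so that the run and the specification can branch
-- on the same object.
run-valid : ∀ imp uf x y {h} → h !? addr (uf-c-imp imp) ≡ just (int , uf-entries uf) →
  Σ[ valid ∈ Dec (x ≡ y ⊎ ufa-α uf x y) ] ∃[ h′ ]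
    (valid-imp imp x y , h ⇓ does valid , h′) × Compresses (uf-c-imp imp) uf h h′
run-valid imp uf x y {h} cell with x ≟ y
... | yes x≡y = yes (inj₁ x≡y) , h , ⇓then (x ≟ y) x≡y ⇓return , compresses-refl cell
... | no  x≢y = case bounds of λ
  { (no out) →
      no (λ { (inj₁ x≡y) → x≢y x≡y ; (inj₂ (x<n , y<n , _)) → out (x<n , y<n) }) , h ,
      ⇓else (x ≟ y) x≢y (⇓bind run-len (⇓else bounds out ⇓return)) ,
      compresses-refl cell
  ; (yes (x<n , y<n)) →
      let h₁ , run₁ , c₁ = run-rep-of-c uf cell x<n
          h₂ , run₂ , c₂ = run-rep-of-c (new-uf c₁) (new-cell c₁)
                             (subst (y <_) (sym (proj₁ (same-reps c₁))) y<n)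
          -- The second find works on the forest that the first one compressed; its result is
          -- translated back to `uf`.
          same-y         = proj₂ (same-reps c₁) y<n
      in map′ (λ eq → inj₂ (x<n , y<n , trans eq same-y))
              (λ { (inj₁ x≡y) → contradiction x≡y x≢y
                 ; (inj₂ (_ , _ , eq)) → trans eq (sym same-y) })
              (ufa-rep-of uf x ≟ ufa-rep-of (new-uf c₁) y) ,
         h₂ ,
         ⇓else (x ≟ y) x≢y (⇓bind run-len (⇓then bounds (x<n , y<n)
           (⇓bind run₁ (⇓bind run₂ ⇓return)))) ,
         compresses-trans c₁ c₂
  }
  where
  bounds : Dec (x < size uf × y < size uf)
  bounds = (x <? size uf) ×-dec (y <? size uf)
  run-len : len (uf-c-imp imp) , h ⇓ size uf , h
  run-len = subst (λ n → len (uf-c-imp imp) , h ⇓ n , h) (length-uf-entries uf) (⇓len cell)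

-- Heaplets

private
  variable
    g g₁ g₂ : Heaplet

splits-left : Splits g g₁ g₂ → ∀ {a c} → g₁ a ≡ just c → g a ≡ just c
splits-left split {a} eq with split a
... | inj₁ (eq₁ , _)     = trans (sym eq₁) eq
... | inj₂ (nothing₁ , _) with () ← trans (sym eq) nothing₁

splits-right : Splits g g₁ g₂ → ∀ {a c} → g₂ a ≡ just c → g a ≡ just c
splits-right split {a} eq with split a
... | inj₂ (_ , eq₂)      = trans (sym eq₂) eq
... | inj₁ (_ , nothing₂) with () ← trans (sym eq) nothing₂

splits-disjoint : Splits g g₁ g₂ → ∀ {a c c′} → g₁ a ≡ just c → g₂ a ≢ just c′
splits-disjoint split {a} eq₁ eq₂ with split a
... | inj₁ (_ , nothing₂) with () ← trans (sym eq₂) nothing₂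
... | inj₂ (nothing₁ , _) with () ← trans (sym eq₁) nothing₁

empty : Heaplet
empty _ = nothing

splits-empty : Splits g g empty
splits-empty a = inj₁ (refl , refl)

override : Heaplet → ℕ → Cell → Heaplet
override g c v a = if does (a ≟ c) then just v else g a

override-same : ∀ {c v} → override g c v c ≡ just v
override-same {c = c} = if-yes (c ≟ c) refl

override-other : ∀ {a c v} → a ≢ c → override g c v a ≡ g a
override-other {a = a} {c} = if-no (a ≟ c)

module _ {c : ℕ} {v w : Cell} where

  -- The part that owns `c` takes the new cell, and the other has nothing there. `g′` is given by
  -- its lookups, which fits both a heap after a run and an `override`.
  splits-updateˡ : ∀ {g′} → g′ c ≡ just w → (∀ {a} → a ≢ c → g′ a ≡ g a) →
    g₁ c ≡ just v → Splits g g₁ g₂ → Splits g′ (override g₁ c w) g₂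
  splits-updateˡ {g₁ = g₁} updated kept own split a with a ≟ c | split a
  ... | yes refl | inj₁ (_ , none₂) = inj₁ (trans (override-same {g = g₁}) (sym updated) , none₂)
  ... | yes refl | inj₂ (none₁ , _) with () ← trans (sym own) none₁
  splits-updateˡ {g₁ = g₁} updated kept own split a | no a≢c | inj₁ (eq₁ , none₂) =
    inj₁ (trans (override-other {g = g₁} a≢c) (trans eq₁ (sym (kept a≢c))) , none₂)
  splits-updateˡ {g₁ = g₁} updated kept own split a | no a≢c | inj₂ (none₁ , eq₂) =
    inj₂ (trans (override-other {g = g₁} a≢c) none₁ , trans eq₂ (sym (kept a≢c)))

splits-comm : Splits g g₁ g₂ → Splits g g₂ g₁
splits-comm split a = Sum.swap (Sum.map swap swap (split a))

splits-override-left : ∀ {c v w} → g₁ c ≡ just v → Splits g g₁ g₂ →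
  Splits (override g c w) (override g₁ c w) g₂
splits-override-left {g = g} = splits-updateˡ (override-same {g = g}) (override-other {g = g})

splits-override-right : ∀ {c v w} → g₂ c ≡ just v → Splits g g₁ g₂ →
  Splits (override g c w) g₁ (override g₂ c w)
splits-override-right own = splits-comm ∘ splits-override-left own ∘ splits-comm

override-↦ : ∀ {t} {arr : Array t} {xs ys} → (arr ↦ xs) g → (arr ↦ ys) (override g (addr arr) (t , ys))
override-↦ {g = g} (_ , others) =
  override-same {g = g} , λ a a≢ → trans (override-other {g = g} a≢) (others a a≢)

-- From assertions to the Hoare triple

is-ufe-represents : ∀ {ufe n imp g h} → is-ufe (ufe , n) imp g →
  (∀ {a c} → g a ≡ just c → h !? a ≡ just c) →
  Represents ufe imp h
is-ufe-represents {ufe} {n} {imp} {h = h}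
  (_ , _ , s , (_ , size≡) , _ , _ , s₁ , (uf-cell , _) , _ , _ , s₂ , (au-cell , _) ,
   ys , _ , _ , s₃ , (us-cell , _) , (_ , _ , take≡)) embed = record
  { uf-cell  = embed (splits-right s (splits-left s₁ uf-cell))
  ; au-cell  = subst (λ n → h !? _ ≡ just (maybe-nat , map (au-ds ufe) (upTo n)))
                 (trans (sym size≡) (sym (size-ufa-unions (uf-init ufe) (unions ufe))))
                 (embed (splits-right s (splits-right s₁ (splits-left s₂ au-cell))))
  ; pairs    = ys
  ; us-cell  = embed (splits-right s (splits-right s₁ (splits-right s₂ (splits-left s₃ us-cell))))
  -- The unions are the occupied initial segment of the backing array.
  ; us-agree = λ {t} eq → !?-take (proj₂ (UFEImp.unions-imp imp)) ys t (trans (cong (_!? t) take≡) eq)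
  }

run-explain : ∀ ufe {imp h x y} → Represents ufe imp h → x ≡ y ⊎ ufa-α (uf-ds ufe) x y →
  call explain′ (imp , x , y) , h ⇓ explain ufe x y , h
run-explain ufe {x = x} reps (inj₁ refl)
  rewrite explain-rev-refl (uf-init ufe) (reverseView (unions ufe)) x = run-explain′-refl ufe reps
run-explain ufe reps (inj₂ α) = run-explain′ ufe reps (reverseView (unions ufe)) (final-stage ufe) α

run-guarded : ∀ ufe {imp h x y} → Represents ufe imp h → (valid : Dec (x ≡ y ⊎ ufa-α (uf-ds ufe) x y)) →
  (if does valid then (call explain′ (imp , x , y) >>= λ p → return (just p)) else return nothing)
    , h ⇓ explain-partial ufe x y , h
run-guarded ufe {x = x} {y} reps valid rewrite explain-partial-≡ ufe valid with valid
... | yes related = ⇓bind (run-explain ufe reps related) ⇓return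
... | no  _       = ⇓return

theorem5 : ∀ (ufe : UFE) (n : ℕ) (imp : UFECImp) (x y : ℕ) →
    ⟨ is-ufe-c (ufe , n) imp ⟩
    explain-partial-imp imp x y
    ⟨ (λ r → is-ufe-c (ufe , n) imp ∗ ↑ (r ≡ explain-partial ufe x y)) ⟩ₜ
theorem5 ufe n imp x y h hₚ frame split
  (g₁ , g₂ , s , ufe-holds@(_ , _ , _ , (_ , init-size) , _) ,
   uf , g₃ , g₄ , s′ , uf-holds , none , refl , reps≡) =
  explain-partial ufe x y , h′ , override hₚ c w ,
  ⇓bind run (run-guarded ufe reps (map′ (Sum.map₂ to) (Sum.map₂ from) valid)) ,
  splits-updateˡ (new-cell comp) (untouched comp) own split ,
  -- Nothing is allocated, so `true-assn` receives the empty heaplet.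
  override hₚ c w , empty , splits-empty ,
  (override hₚ c w , empty , splits-empty ,
    (g₁ , override g₂ c w , splits-override-right own₂ s , ufe-holds ,
     new-uf comp , override g₃ c w , g₄ , splits-override-left own₃ s′ ,
     override-↦ uf-holds , none , proj₁ (same-reps comp) ,
     λ i<n → trans (proj₂ (same-reps comp) i<n) (reps≡ i<n)) ,
    (λ _ → refl) , refl) ,
  tt
  where
  c = addr (uf-c-imp imp)
  own₃ : g₃ c ≡ just (int , uf-entries uf)
  own₃ = proj₁ uf-holds
  own₂ : g₂ c ≡ just (int , uf-entries uf)
  own₂ = splits-left s′ own₃
  own : hₚ c ≡ just (int , uf-entries uf)
  own = splits-right s own₂
  validation = run-valid imp uf x y (splits-left split own)
  valid      = proj₁ validation
  h′         = proj₁ (proj₂ validation)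
  run        = proj₁ (proj₂ (proj₂ validation))
  comp       = proj₂ (proj₂ (proj₂ validation))
  w : Cell
  w = int , uf-entries (new-uf comp)
  reps : Represents ufe (ufe-imp imp) h′
  reps = is-ufe-represents ufe-holds λ eq →
    -- The cells of the `is-ufe` part are disjoint from the path-compressed array, so the finds left
    -- them as they were.
    trans (untouched comp (λ { refl → splits-disjoint s eq own₂ }))
          (splits-left split (splits-left s eq))
  size≡ : size (uf-ds ufe) ≡ size uf
  size≡ = trans (size-ufa-unions (uf-init ufe) (unions ufe)) init-size
  to : ufa-α uf x y → ufa-α (uf-ds ufe) x y
  to (x<n , y<n , eq) = subst (x <_) (sym size≡) x<n , subst (y <_) (sym size≡) y<n ,
                        trans (sym (reps≡ x<n)) (trans eq (reps≡ y<n))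
  from : ufa-α (uf-ds ufe) x y → ufa-α uf x y
  from (x<n′ , y<n′ , eq) = x<n , y<n , trans (reps≡ x<n) (trans eq (sym (reps≡ y<n)))
    where
    x<n = subst (x <_) size≡ x<n′
    y<n = subst (y <_) size≡ y<n′
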